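{- Let $k$ be a positive integer. For every integer $n\ge \frac{9}{2}k^2+\frac{13}{4}k+\frac{49}{32}$, $$(k-1)n-(k-1)^2\le \mathrm{lbal}(n,C_{4k})=\mathrm{bal}(n,C_{4k})<(k-1)n+12k^2+3k.$$
   Context: $C_\ell$ is the cycle on $\ell$ vertices. A 2-coloring of the edges of $K_n$ is a partition $E(K_n)=R\sqcup B$ (red edges and blue edges). A 2-list coloring of the edges of $K_n$ is a function $L:E(K_n)\to\{\{r\},\{b\},\{r,b\}\}$; it induces color classes $R=\{e: r\in L(e)\}$ and $B=\{e: b\in L(e)\}$ (which may intersect). Given a 2-coloring or a 2-list coloring with color classes $R,B$, a balanced copy of a graph $G=G(V,E)$ is a (not necessarily induced) copy of $G$ in $K_n$ whose edge set has a partition $E_1\sqcup E_2$ with $E_1\subseteq R$, $E_2\subseteq B$ and $\bigl||E_1|-|E_2|\bigr|\le 1$. Balancing number: $\mathrm{bal}(n,G)$ is the smallest integer $k$ such that every 2-coloring $R\sqcup B$ of the edges of $K_n$ with $|R|,|B|>k$ contains a balanced copy of $G$, where the condition $|R|,|B|>k$ is required to be satisfiable by some 2-coloring, i.e. $2(k+1)\le\binom{n}{2}$. List balancing number: for $n\ge |V|$, $\mathrm{lbal}(n,G)$ is the smallest integer $k$ such that every 2-list coloring of the edges of $K_n$ with color classes satisfying $|R|,|B|>k$ contains a balanced copy of $G$. -}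

module Defs where

open import Data.Bool using (Bool; true; false; T; not; _∧_; _∨_)
open import Data.Bool.Properties using (T?; ∨-comm)
open import Data.Fin using (Fin; toℕ; _<?_; _≟_)
open import Data.Integer as ℤ using (ℤ; +_; 1ℤ)
open import Data.List using (allFin; cartesianProduct; filter; length)
open import Data.Nat as ℕ using (ℕ; suc; _≡ᵇ_; ∣_-_∣)
open import Data.Nat.Combinatorics using (_C_)
open import Data.Product using (_×_; _,_)
open import Function.Definitions using (Injective)
open import Relation.Binary.PropositionalEquality
  using (_≡_; refl; sym; cong; cong₂)
open import Relation.Nullary using (yes; no; contradiction)
open import Relation.Nullary.Decidable using (⌊_⌋; _×-dec_)

-- A set of edges of Kₙ, equivalently a simple graph on the vertex set Fin n.
record EdgeSet (n : ℕ) : Set where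
  field
    adj         : Fin n → Fin n → Bool
    symmetric   : ∀ u v → adj u v ≡ adj v u
    irreflexive : ∀ u → adj u u ≡ false

open EdgeSet public

size : ∀ {n} → EdgeSet n → ℕ
size {n} E =
  length (filter (λ (u , v) → (u <? v) ×-dec T? (adj E u v))
                 (cartesianProduct (allFin n) (allFin n)))

-- E ≐ E₁ ⊔ E₂ : either part may be empty.
record _≐_⊔_ {n : ℕ} (E E₁ E₂ : EdgeSet n) : Set where
  field
    cover    : ∀ u v → adj E u v ≡ adj E₁ u v ∨ adj E₂ u v
    disjoint : ∀ u v → adj E₁ u v ∧ adj E₂ u v ≡ false

distinct : ∀ {n} → Fin n → Fin n → Bool
distinct u v = not ⌊ u ≟ v ⌋

distinct-sym : ∀ {n} (u v : Fin n) → distinct u v ≡ distinct v u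
distinct-sym u v with u ≟ v | v ≟ u
... | yes _ | yes _ = refl
... | no _  | no _  = refl
... | yes p | no q  = contradiction (sym p) q
... | no p  | yes q = contradiction (sym q) p

distinct-irrefl : ∀ {n} (u : Fin n) → distinct u u ≡ false
distinct-irrefl u with u ≟ u
... | yes _ = refl
... | no p  = contradiction refl p

offDiagonal : ∀ {n} (f : Fin n → Fin n → Bool) →
              (∀ u v → f u v ≡ f v u) → EdgeSet n
offDiagonal f f-sym = record
  { adj         = λ u v → distinct u v ∧ f u v
  ; symmetric   = λ u v → cong₂ _∧_ (distinct-sym u v) (f-sym u v)
  ; irreflexive = λ u → cong (_∧ f u u) (distinct-irrefl u)
  }

complete : (n : ℕ) → EdgeSet n
complete n = offDiagonal (λ _ _ → true) (λ _ _ → refl)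

-- v follows u in the cyclic order 0, 1, …, ℓ - 1, 0.
follows : ∀ {ℓ} → Fin ℓ → Fin ℓ → Bool
follows {ℓ} u v =
  (suc (toℕ u) ≡ᵇ toℕ v) ∨ ((suc (toℕ u) ≡ᵇ ℓ) ∧ (toℕ v ≡ᵇ 0))

-- This is the usual cycle for ℓ ≥ 3.
cycle : (ℓ : ℕ) → EdgeSet ℓ
cycle ℓ = offDiagonal (λ u v → follows u v ∨ follows v u)
                      (λ u v → ∨-comm (follows u v) (follows v u))

data Palette : Set where
  ⟨r⟩ ⟨b⟩ ⟨rb⟩ : Palette

hasRed hasBlue : Palette → Bool
hasRed ⟨r⟩  = true
hasRed ⟨b⟩  = false
hasRed ⟨rb⟩ = true
hasBlue ⟨r⟩  = false
hasBlue ⟨b⟩  = true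
hasBlue ⟨rb⟩ = true

-- A function on unordered pairs; its values on the diagonal are never used.
record ListColouring (n : ℕ) : Set where
  field
    list     : Fin n → Fin n → Palette
    list-sym : ∀ u v → list u v ≡ list v u

  red blue : EdgeSet n
  red  = offDiagonal (λ u v → hasRed (list u v))
                     (λ u v → cong hasRed (list-sym u v))
  blue = offDiagonal (λ u v → hasBlue (list u v))
                     (λ u v → cong hasBlue (list-sym u v))

open ListColouring public

-- The copy of G is its image under φ. As φ is injective, partitions of the
-- edge set of the copy correspond to partitions E₁ ⊔ E₂ of that of G.
record BalancedCopy {n p : ℕ} (R B : EdgeSet n) (G : EdgeSet p) : Set where
  field
    φ         : Fin p → Fin n
    injective : Injective _≡_ _≡_ φ
    E₁ E₂     : EdgeSet p
    partition : G ≐ E₁ ⊔ E₂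
    E₁⊆R      : ∀ u v → T (adj E₁ u v) → T (adj R (φ u) (φ v))
    E₂⊆B      : ∀ u v → T (adj E₂ u v) → T (adj B (φ u) (φ v))
    balanced  : ∣ size E₁ - size E₂ ∣ ℕ.≤ 1

IsSmallest : (ℤ → Set) → ℤ → Set
IsSmallest P m = P m × (∀ j → P j → m ℤ.≤ j)

-- The second component says that |R|, |B| > k holds for some 2-coloring.
Balances : ∀ {p} → ℕ → EdgeSet p → ℤ → Set
Balances n G k =
  (∀ (R B : EdgeSet n) → complete n ≐ R ⊔ B →
     k ℤ.< + size R → k ℤ.< + size B → BalancedCopy R B G)
  × (+ 2 ℤ.* (k ℤ.+ 1ℤ) ℤ.≤ + (n C 2))

ListBalances : ∀ {p} → ℕ → EdgeSet p → ℤ → Set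
ListBalances n G k =
  ∀ (L : ListColouring n) →
    k ℤ.< + size (red L) → k ℤ.< + size (blue L) →
    BalancedCopy (red L) (blue L) G

-- bal and lbal are given as relations: IsBal n G m means bal(n, G) = m.
IsBal : ∀ {p} → ℕ → EdgeSet p → ℤ → Set
IsBal n G = IsSmallest (Balances n G)

-- lbal(n, G) is defined only when n is at least the order p of G.
IsLbal : ∀ {p} → ℕ → EdgeSet p → ℤ → Set
IsLbal {p} n G m = (p ℕ.≤ n) × IsSmallest (ListBalances n G) m

{-# OPTIONS --safe #-}
module Submission where

-- Call a cycle rich in a colour if at least half of its 4k edges have that colour.
--
-- Rich red and rich blue cycles together force a balanced one. Replacing one vertex of a cycle
-- changes its number of red edges by at most 2, so moving from a red-rich cycle to a blue-rich one
-- by such replacements meets 2k red edges, jumps from 2k + 1 to 2k - 1, or (only possible when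
-- edges carry both colours) ends at a cycle rich in both, which is balanced as well. At a jump the
-- common path P = p₁ … p_{4k-1} has 2k - 1 red edges. Unless a balanced cycle arises, for a vertex z
-- off both cycles the paths p_{i-1} p_i p_{i+1} and p_{i-1} z p_{i+1} have equal red parity for every i;
-- over even i these add up to: p₁z and zp_{4k-1} differ in colour, as 2k - 1 is odd. Then z closes P
-- to a balanced cycle.
--
-- Hence both numbers equal the largest size of a graph without a rich cycle. It is at least
-- (k-1)(n-k+1), by the complete bipartite graph with parts k-1 and n-k+1. It is less than
-- (k-1)n + 12k² + 3k: k vertices of degree at least 3k carry k disjoint paths with two edges, and
-- with at most k-1 such vertices the remaining edges contain a matching of size 2k.

open import Defs
open import Data.Bool using (Bool; true; false; T; not; _∧_; _∨_; _xor_)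
open import Data.Bool.Properties using (T?; T-∨; T-∧; T-≡; ∧-zeroʳ; ∨-comm; ∨-identityʳ; ∨-idem; not-involutive; xor-assoc; xor-comm)
open import Data.Empty using (⊥; ⊥-elim)
open import Data.Fin as Fin using (Fin; zero; suc; toℕ; fromℕ; inject₁; _≟_; _<?_)
import Data.Fin.Properties as Fin
open import Data.Fin.Relation.Unary.Top using (view; ‵fromℕ; ‵inject₁; view-fromℕ; view-inject₁)
open import Data.Integer as ℤ using (ℤ; 1ℤ)
import Data.Integer.Properties as ℤ
open import Data.List using (List; []; _∷_; _++_; [_]; _∷ʳ_; length; filter; map; tabulate; allFin; cartesianProduct; take; lookup; initLast; _∷ʳ′_)
open import Data.List.Membership.Propositional using (_∈_; _∉_)
open import Data.List.Membership.Propositional.Properties using (∈-++⁺ˡ; ∈-++⁺ʳ; ∈-++⁻; ∈-∃++; ∈-lookup; ∈-filter⁺; ∈-allFin)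
open import Data.List.Properties using (++-assoc; ++-identityʳ; filter-++; length-++; length-++-sucʳ; length-tabulate; length-take; map-++; tabulate-lookup)
open import Data.List.Relation.Binary.Permutation.Propositional using (_↭_; ↭⇒↭ₛ; ↭-sym)
open import Data.List.Relation.Binary.Permutation.Propositional.Properties using (shift; ↭-length; ++-comm; ∈-resp-↭)
import Data.List.Relation.Binary.Permutation.Setoid.Properties as Permutation
open import Data.List.Relation.Unary.All as All using (All; []; _∷_)
import Data.List.Relation.Unary.All.Properties as All
open import Data.List.Relation.Unary.AllPairs as AllPairs using ([]; _∷_)
open import Data.List.Relation.Unary.Any using (here; there)
open import Data.List.Relation.Unary.Unique.Propositional using (Unique)
import Data.List.Relation.Unary.Unique.Propositional.Properties as Unique
open import Data.Nat as ℕ hiding (_≟_; _<?_)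
open import Data.Nat.Combinatorics using (_C_; nC1≡n; nCk+nC[k+1]≡[n+1]C[k+1])
open import Data.Nat.ListAction using () renaming (sum to sumᴸ)
open import Data.Nat.ListAction.Properties using (sum-++)
open import Data.Nat.Properties hiding (_≟_; _<?_)
open import Data.Nat.Tactic.RingSolver using (solve-∀)
open import Data.Product using (Σ; ∃; _×_; _,_; proj₁; proj₂; ∃-syntax)
open import Data.Sum using (_⊎_; inj₁; inj₂)
open import Data.Unit using (tt)
open import Data.Vec as Vec using (Vec; []; _∷_)
open import Data.Vec.Properties using (length-toList; toList∘fromList; lookup∘tabulate)
open import Function using (_∘_; id)
open import Function.Bundles using (Equivalence)
open import Relation.Binary using (Tri; tri<; tri≈; tri>)
open import Relation.Binary.PropositionalEquality hiding ([_])
open import Relation.Nullary using (¬_; Dec; yes; no; does; contradiction)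
open import Relation.Nullary.Decidable using (_×-dec_; _⊎-dec_; ¬?; map′; decidable-stable; dec-true; dec-false)
open import Relation.Unary using (Decidable)
open import Algebra.Properties.Semiring.Sum +-*-semiring
  using (sum; sum-cong-≗; ∑-distrib-+; ∑-comm; *-distribˡ-sum; *-distribʳ-sum; sum-init-last)
open Equivalence using (to; from)

-- Counting edges

ind : Bool → ℕ
ind true  = 1
ind false = 0

ind≤1 : ∀ b → ind b ≤ 1
ind≤1 true  = s≤s z≤n
ind≤1 false = z≤n

sum-mono : ∀ {n} {f g : Fin n → ℕ} → (∀ i → f i ≤ g i) → sum f ≤ sum g
sum-mono {zero}  f≤g = z≤n
sum-mono {suc n} f≤g = +-mono-≤ (f≤g zero) (sum-mono (f≤g ∘ suc))

sum-const : ∀ n c → sum {n} (λ _ → c) ≡ n * c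
sum-const zero    c = refl
sum-const (suc n) c = cong (c +_) (sum-const n c)

sum-zero : ∀ {n} {f : Fin n → ℕ} → (∀ i → f i ≡ 0) → sum f ≡ 0
sum-zero {n} f≡0 = trans (sum-cong-≗ f≡0) (trans (sum-const n 0) (*-zeroʳ n))

sum-single : ∀ {n} (f : Fin n → ℕ) j → (∀ i → i ≢ j → f i ≡ 0) → sum f ≡ f j
sum-single f zero    f≡0 =
  trans (cong (f zero +_) (sum-zero λ i → f≡0 (suc i) λ ())) (+-identityʳ _)
sum-single f (suc j) f≡0 =
  cong₂ _+_ (f≡0 zero λ ()) (sum-single (f ∘ suc) j λ i i≢j → f≡0 (suc i) (i≢j ∘ Fin.suc-injective))

sum-≟ : ∀ {n} (f : Fin n → ℕ) j → sum (λ i → ind (does (j ≟ i)) * f i) ≡ f j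
sum-≟ f j = trans
  (sum-single _ j λ i i≢j → cong (λ b → ind b * f i) (dec-false (j ≟ i) (i≢j ∘ sym)))
  (trans (cong (λ b → ind b * f j) (dec-true (j ≟ j) refl)) (*-identityˡ _))

∑∑ : ∀ {m n} → (Fin m → Fin n → ℕ) → ℕ
∑∑ f = sum λ u → sum (f u)

∑∑-cong : ∀ {m n} {f g : Fin m → Fin n → ℕ} → (∀ u v → f u v ≡ g u v) → ∑∑ f ≡ ∑∑ g
∑∑-cong f≡g = sum-cong-≗ λ u → sum-cong-≗ (f≡g u)

∑∑-mono : ∀ {m n} {f g : Fin m → Fin n → ℕ} → (∀ u v → f u v ≤ g u v) → ∑∑ f ≤ ∑∑ g
∑∑-mono f≤g = sum-mono λ u → sum-mono (f≤g u)

∑∑-distrib-+ : ∀ {m n} (f g : Fin m → Fin n → ℕ) → ∑∑ (λ u v → f u v + g u v) ≡ ∑∑ f + ∑∑ g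
∑∑-distrib-+ f g = trans (sum-cong-≗ λ u → ∑-distrib-+ (f u) (g u))
  (∑-distrib-+ (λ u → sum (f u)) (λ u → sum (g u)))

∑∑-* : ∀ {m n} (f : Fin m → ℕ) (g : Fin n → ℕ) → ∑∑ (λ u v → f u * g v) ≡ sum f * sum g
∑∑-* f g = trans (sum-cong-≗ λ u → sym (*-distribˡ-sum (f u) g)) (sym (*-distribʳ-sum (sum g) f))

-- Serves for double counting: once every edge is split into an arc and its reverse, of which
-- exactly one contributes, the symmetric count becomes twice the count of arcs.
∑∑-flip : ∀ {n} (f : Fin n → Fin n → ℕ) → ∑∑ (λ u v → f u v + f v u) ≡ 2 * ∑∑ f
∑∑-flip f = trans (∑∑-distrib-+ f (λ u v → f v u))
  (cong (∑∑ f +_) (trans (∑-comm (λ u v → f v u)) (sym (+-identityʳ _))))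

module _ {A B : Set} {P : A × B → Set} (P? : Decidable P) where

  length-filter-tabulate : ∀ {n} (x : A) (g : Fin n → B) →
    length (filter P? (map (x ,_) (tabulate g))) ≡ sum (λ j → ind (does (P? (x , g j))))
  length-filter-tabulate {zero}  x g = refl
  length-filter-tabulate {suc n} x g with does (P? (x , g zero))
  ... | true  = cong suc (length-filter-tabulate x (g ∘ suc))
  ... | false = length-filter-tabulate x (g ∘ suc)

  length-filter-product : ∀ {m n} (f : Fin m → A) (g : Fin n → B) →
    length (filter P? (cartesianProduct (tabulate f) (tabulate g)))
      ≡ ∑∑ (λ i j → ind (does (P? (f i , g j))))
  length-filter-product {zero}  f g = refl
  length-filter-product {suc m} f g = begin
    length (filter P? (row ++ rest))                  ≡⟨ cong length (filter-++ P? row rest) ⟩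
    length (filter P? row ++ filter P? rest)          ≡⟨ length-++ (filter P? row) ⟩
    length (filter P? row) + length (filter P? rest)
      ≡⟨ cong₂ _+_ (length-filter-tabulate (f zero) g) (length-filter-product (f ∘ suc) g) ⟩
    _ ∎
    where
    open ≡-Reasoning
    row  = map (f zero ,_) (tabulate g)
    rest = cartesianProduct (tabulate (f ∘ suc)) (tabulate g)

-- Of the two orientations of an edge exactly one is increasing, and the diagonal contributes
-- nothing. The right-hand side does not mention the order of the vertices, so sizes are compared
-- below after doubling.
handshake : ∀ {n} (E : EdgeSet n) → 2 * size E ≡ ∑∑ (λ u v → ind (adj E u v))
handshake {n} E = begin
  2 * size E                        ≡⟨ cong (2 *_) (length-filter-product (λ (u , v) → (u <? v) ×-dec T? (adj E u v)) id id) ⟩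
  2 * ∑∑ up                         ≡⟨ ∑∑-flip up ⟨
  ∑∑ (λ u v → up u v + up v u)      ≡⟨ ∑∑-cong split ⟩
  ∑∑ (λ u v → ind (adj E u v))      ∎
  where
  open ≡-Reasoning
  up : Fin n → Fin n → ℕ
  up u v = ind (does (u <? v) ∧ adj E u v)
  split : ∀ u v → up u v + up v u ≡ ind (adj E u v)
  split u v with Fin.<-cmp u v
  ... | tri< a ¬b ¬c rewrite dec-true (u <? v) a | dec-false (v <? u) ¬c = +-identityʳ _
  ... | tri≈ ¬a refl ¬c rewrite dec-false (u <? u) ¬a | irreflexive E u = refl
  ... | tri> ¬a ¬b c rewrite dec-true (v <? u) c | dec-false (u <? v) ¬a = cong ind (symmetric E v u)

size-cong : ∀ {n} (E F : EdgeSet n) → (∀ u v → adj E u v ≡ adj F u v) → size E ≡ size F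
size-cong E F E≡F = *-cancelˡ-≡ _ _ 2
  (trans (handshake E) (trans (∑∑-cong λ u v → cong ind (E≡F u v)) (sym (handshake F))))

2*nC2 : ∀ n → 2 * (n C 2) + n ≡ n * n
2*nC2 zero    = refl
2*nC2 (suc n) = begin
  2 * (suc n C 2) + suc n        ≡⟨ cong (λ c → 2 * c + suc n) (nCk+nC[k+1]≡[n+1]C[k+1] n 1) ⟨
  2 * (n C 1 + n C 2) + suc n    ≡⟨ cong (λ c → 2 * (c + n C 2) + suc n) (nC1≡n n) ⟩
  2 * (n + n C 2) + suc n        ≡⟨ regroup n (n C 2) ⟩
  2 * n + 1 + (2 * (n C 2) + n)  ≡⟨ cong (2 * n + 1 +_) (2*nC2 n) ⟩
  2 * n + 1 + n * n              ≡⟨ square n ⟩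
  suc n * suc n                  ∎
  where
  open ≡-Reasoning
  regroup : ∀ n c → 2 * (n + c) + suc n ≡ 2 * n + 1 + (2 * c + n)
  regroup = solve-∀
  square : ∀ n → 2 * n + 1 + n * n ≡ suc n * suc n
  square = solve-∀

complement : ∀ {n} → EdgeSet n → EdgeSet n
complement E = offDiagonal (λ u v → not (adj E u v)) (λ u v → cong not (symmetric E u v))

-- An ordered pair is an edge, a non-edge or a diagonal pair, so the three indicators add up to 1;
-- summing over all pairs gives `n * n`.
size-complement : ∀ {n} (E : EdgeSet n) → size E + size (complement E) ≡ n C 2
size-complement {n} E = *-cancelˡ-≡ _ _ 2 (+-cancelʳ-≡ n _ _ (begin
  2 * (size E + size (complement E)) + n
    ≡⟨ cong (_+ n) (*-distribˡ-+ 2 (size E) _) ⟩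
  2 * size E + 2 * size (complement E) + n
    ≡⟨ cong₂ (λ a b → a + b + n) (handshake E) (handshake (complement E)) ⟩
  ∑∑ e + ∑∑ ē + n
    ≡⟨ cong₂ _+_ (∑∑-distrib-+ e ē) diagonal ⟨
  ∑∑ (λ u v → e u v + ē u v) + ∑∑ {n} {n} (λ u v → ind (does (u ≟ v)) * 1)
    ≡⟨ ∑∑-distrib-+ (λ u v → e u v + ē u v) _ ⟨
  ∑∑ (λ u v → e u v + ē u v + ind (does (u ≟ v)) * 1)
    ≡⟨ ∑∑-cong total ⟩
  ∑∑ {n} {n} (λ _ _ → 1)
    ≡⟨ trans (sum-cong-≗ {n} λ _ → trans (sum-const n 1) (*-identityʳ n)) (sum-const n n) ⟩
  n * n
    ≡⟨ 2*nC2 n ⟨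
  2 * (n C 2) + n ∎))
  where
  open ≡-Reasoning
  e ē : Fin n → Fin n → ℕ
  e u v = ind (adj E u v)
  ē u v = ind (adj (complement E) u v)
  diagonal : ∑∑ {n} {n} (λ u v → ind (does (u ≟ v)) * 1) ≡ n
  diagonal = trans (sum-cong-≗ {n} (sum-≟ (λ _ → 1))) (trans (sum-const n 1) (*-identityʳ n))
  total : ∀ u v → e u v + ē u v + ind (does (u ≟ v)) * 1 ≡ 1
  total u v with u ≟ v
  ... | yes refl rewrite irreflexive E u = refl
  ... | no _ with adj E u v
  ...   | true  = refl
  ...   | false = refl

-- Balanced copies of a cycle

-- As a function, the cyclic successor lets a vertex `u` stand for the edge from `u` to `next u`, so
-- that edges of the cycle are indexed by `Fin`.
next : ∀ {p} → Fin (suc p) → Fin (suc p)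
next u with view u
... | ‵fromℕ     = zero
... | ‵inject₁ i = suc i

next-inject₁ : ∀ {p} (i : Fin p) → next (inject₁ i) ≡ suc i
next-inject₁ i rewrite view-inject₁ i = refl

next-fromℕ : ∀ p → next (fromℕ p) ≡ zero
next-fromℕ p rewrite view-fromℕ p = refl

≟-toℕ : ∀ {n} (i j : Fin n) → does (i ≟ j) ≡ (toℕ i ≡ᵇ toℕ j)
≟-toℕ zero    zero    = refl
≟-toℕ zero    (suc j) = refl
≟-toℕ (suc i) zero    = refl
≟-toℕ (suc i) (suc j) = ≟-toℕ i j

≡ᵇ-true : ∀ m → (m ≡ᵇ m) ≡ true
≡ᵇ-true zero    = refl
≡ᵇ-true (suc m) = ≡ᵇ-true m

≡ᵇ-false : ∀ {m n} → m ≢ n → (m ≡ᵇ n) ≡ false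
≡ᵇ-false {zero}  {zero}  m≢n = contradiction refl m≢n
≡ᵇ-false {zero}  {suc n} m≢n = refl
≡ᵇ-false {suc m} {zero}  m≢n = refl
≡ᵇ-false {suc m} {suc n} m≢n = ≡ᵇ-false (m≢n ∘ cong suc)

follows≡next : ∀ {p} (u v : Fin (suc p)) → follows u v ≡ does (next u ≟ v)
follows≡next {p} u v with view u
... | ‵fromℕ
  rewrite Fin.toℕ-fromℕ p
        | ≡ᵇ-false {suc p} {toℕ v} (<⇒≢ (Fin.toℕ<n v) ∘ sym)
        | ≡ᵇ-true p
  = trans (≡ᵇ-sym (toℕ v)) (sym (≟-toℕ zero v))
  where
  ≡ᵇ-sym : ∀ m → (m ≡ᵇ 0) ≡ (0 ≡ᵇ m)
  ≡ᵇ-sym zero    = refl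
  ≡ᵇ-sym (suc m) = refl
... | ‵inject₁ i
  rewrite Fin.toℕ-inject₁ i
        | ≡ᵇ-false {toℕ i} {p} (<⇒≢ (Fin.toℕ<n i))
  = trans (∨-identityʳ _) (sym (≟-toℕ (suc i) v))

follows-next : ∀ {p} (u : Fin (suc p)) → follows u (next u) ≡ true
follows-next u = trans (follows≡next u (next u)) (dec-true (next u ≟ next u) refl)

follows⇒next : ∀ {p} (u v : Fin (suc p)) → T (follows u v) → next u ≡ v
follows⇒next u v f with next u ≟ v | follows≡next u v
... | yes eq | _  = eq
... | no _   | eq = ⊥-elim (subst T eq f)

-- Two vertices that follow each other would make up the whole cycle, of length at most 2. This is
-- what gives every edge of the cycle a unique orientation.
follows-asym : ∀ {ℓ} → 3 ≤ ℓ → (u v : Fin ℓ) → T (follows u v) → ¬ T (follows v u)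
follows-asym {ℓ} 3≤ℓ u v fuv fvu = cases (split u v fuv) (split v u fvu)
  where
  split : (x y : Fin ℓ) → T (follows x y) →
          suc (toℕ x) ≡ toℕ y ⊎ (suc (toℕ x) ≡ ℓ × toℕ y ≡ 0)
  split x y f with T-∨ .to f
  ... | inj₁ e = inj₁ (≡ᵇ⇒≡ _ _ e)
  ... | inj₂ e with T-∧ .to e
  ...   | e₁ , e₂ = inj₂ (≡ᵇ⇒≡ _ _ e₁ , ≡ᵇ⇒≡ _ _ e₂)
  short : ∀ {m} → suc m ≡ ℓ → m ≤ 1 → ⊥
  short refl m≤1 = <-irrefl refl (≤-trans 3≤ℓ (s≤s m≤1))
  cases : suc (toℕ u) ≡ toℕ v ⊎ (suc (toℕ u) ≡ ℓ × toℕ v ≡ 0) →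
          suc (toℕ v) ≡ toℕ u ⊎ (suc (toℕ v) ≡ ℓ × toℕ u ≡ 0) → ⊥
  cases (inj₁ a) (inj₁ b) = m≢1+n+m (toℕ u) {1} (trans (sym b) (cong suc (sym a)))
  cases (inj₁ a) (inj₂ (b , c)) = short b (≤-reflexive (trans (sym a) (cong suc c)))
  cases (inj₂ (a , b)) (inj₁ c) = short a (≤-reflexive (trans (sym c) (cong suc b)))
  cases (inj₂ (a , b)) (inj₂ (c , d)) = short a (≤-trans (≤-reflexive d) z≤n)

¬T⇒false : ∀ {b} → ¬ T b → b ≡ false
¬T⇒false {true}  ¬b = contradiction tt ¬b
¬T⇒false {false} ¬b = refl

ind-T : ∀ {b} → T b → ind b ≡ 1
ind-T {true} _ = refl

ind-mono : ∀ {a b} → (T a → T b) → ind a ≤ ind b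
ind-mono {false}         _   = z≤n
ind-mono {true}  {true}  _   = ≤-refl
ind-mono {true}  {false} a⇒b = ⊥-elim (a⇒b tt)

ind-not : ∀ b → ind b + ind (not b) ≡ 1
ind-not true  = refl
ind-not false = refl

-- A discrete intermediate value theorem: enlarging `lo` to `hi` one element at a time passes
-- through every size in between. It will decide the colour of those edges that carry both.
between : ∀ {n} (lo hi : Fin n → Bool) → (∀ i → T (lo i) → T (hi i)) →
          ∀ {t} → sum (ind ∘ lo) ≤ t → t ≤ sum (ind ∘ hi) →
          ∃[ f ] (∀ i → T (lo i) → T (f i)) × (∀ i → T (f i) → T (hi i)) × sum (ind ∘ f) ≡ t
between {zero}  lo hi lo⇒hi {zero} _ _ = lo , (λ ()) , (λ ()) , refl
between {suc n} lo hi lo⇒hi {t} lo≤t t≤hi = step _ _ (λ l → l) (λ h → h) (lo⇒hi zero) t lo≤t t≤hi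
  where
  prepend : ∀ b → (T (lo zero) → T b) → (T b → T (hi zero)) → ∀ {t} →
            sum (ind ∘ lo ∘ suc) ≤ t → t ≤ sum (ind ∘ hi ∘ suc) →
            ∃[ f ] (∀ i → T (lo i) → T (f i)) × (∀ i → T (f i) → T (hi i)) × sum (ind ∘ f) ≡ ind b + t
  prepend b lo⇒b b⇒hi lo≤t t≤hi with between (lo ∘ suc) (hi ∘ suc) (lo⇒hi ∘ suc) lo≤t t≤hi
  ... | f , lo⇒f , f⇒hi , sum≡t =
    (λ { zero → b ; (suc i) → f i }) ,
    (λ { zero → lo⇒b ; (suc i) → lo⇒f i }) ,
    (λ { zero → b⇒hi ; (suc i) → f⇒hi i }) ,
    cong (ind b +_) sum≡t
  step : ∀ l h → (T (lo zero) → T l) → (T h → T (hi zero)) → (T l → T h) → ∀ t →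
         ind l + sum (ind ∘ lo ∘ suc) ≤ t → t ≤ ind h + sum (ind ∘ hi ∘ suc) →
         ∃[ f ] (∀ i → T (lo i) → T (f i)) × (∀ i → T (f i) → T (hi i)) × sum (ind ∘ f) ≡ t
  step true  false _ _ l⇒h _ _ _ = ⊥-elim (l⇒h tt)
  step true  true  lo⇒l h⇒hi _ (suc t) (s≤s lo≤t) (s≤s t≤hi) = prepend true lo⇒l h⇒hi lo≤t t≤hi
  step false false lo⇒l h⇒hi _ t lo≤t t≤hi = prepend false lo⇒l (λ ()) lo≤t t≤hi
  -- An optional element is taken only if the later ones cannot supply `t` elements by themselves.
  step false true  lo⇒l h⇒hi _ t lo≤t t≤hi with t ≤? sum (ind ∘ hi ∘ suc)
  step false true  lo⇒l h⇒hi _ t lo≤t t≤hi | yes t≤ = prepend false lo⇒l (λ ()) lo≤t t≤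
  step false true  lo⇒l h⇒hi _ zero lo≤t t≤hi | no t≰ = contradiction z≤n t≰
  step false true  lo⇒l h⇒hi _ (suc t) lo≤t (s≤s t≤hi) | no t≰ =
    prepend true _ h⇒hi (≤-trans (sum-mono λ i → ind-mono (lo⇒hi (suc i))) (s≤s⁻¹ (≰⇒> t≰))) t≤hi

distinct-≢ : ∀ {n} {u v : Fin n} → u ≢ v → distinct u v ≡ true
distinct-≢ {u = u} {v} u≢v with u ≟ v
... | yes u≡v = contradiction u≡v u≢v
... | no _    = refl

module CycleGraph {p : ℕ} (3≤ℓ : 3 ≤ suc p) where

  follows-back : (u : Fin (suc p)) → follows (next u) u ≡ false
  follows-back u = ¬T⇒false (follows-asym 3≤ℓ u (next u) (T-≡ .from (follows-next u)))

  distinct-next : (u : Fin (suc p)) → distinct u (next u) ≡ true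
  distinct-next u = distinct-≢ λ u≡next →
    let fuu = subst (T ∘ follows u) (sym u≡next) (T-≡ .from (follows-next u))
    in follows-asym 3≤ℓ u u fuu fuu

  -- Orient each edge along the cycle. By `follows-asym` exactly one of its two arcs survives, and a
  -- vertex is the start of at most one arc.
  size-in-cycle : (E : EdgeSet (suc p)) → (∀ u v → T (adj E u v) → T (adj (cycle (suc p)) u v)) →
                  size E ≡ sum (λ u → ind (adj E u (next u)))
  size-in-cycle E E⊆cycle = *-cancelˡ-≡ _ _ 2 (begin
    2 * size E                                 ≡⟨ handshake E ⟩
    ∑∑ (λ u v → ind (adj E u v))               ≡⟨ ∑∑-cong orient ⟩
    ∑∑ (λ u v → arc u v + arc v u)             ≡⟨ ∑∑-flip arc ⟩
    2 * ∑∑ arc                                 ≡⟨ cong (2 *_) (sum-cong-≗ λ u → sum-≟ (λ v → ind (adj E u v)) (next u)) ⟩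
    2 * sum (λ u → ind (adj E u (next u)))     ∎)
    where
    open ≡-Reasoning
    arc : Fin (suc p) → Fin (suc p) → ℕ
    arc u v = ind (does (next u ≟ v)) * ind (adj E u v)
    orient : ∀ u v → ind (adj E u v) ≡ arc u v + arc v u
    orient u v rewrite sym (follows≡next u v) | sym (follows≡next v u) | symmetric E v u =
      split (adj E u v) (follows u v) (follows v u)
            (λ e → proj₂ (T-∧ {distinct u v} .to (E⊆cycle u v e))) (follows-asym 3≤ℓ u v)
      where
      split : ∀ e a b → (T e → T (a ∨ b)) → (T a → ¬ T b) → ind e ≡ ind a * ind e + ind b * ind e
      split true  true  true  _ asym = contradiction tt (asym tt)
      split true  true  false _ _    = refl
      split true  false true  _ _    = refl
      split true  false false c _    = ⊥-elim (c tt)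
      split false a     b     _ _    = sym (cong₂ _+_ (*-zeroʳ (ind a)) (*-zeroʳ (ind b)))

  cycle-next : (u : Fin (suc p)) → adj (cycle (suc p)) u (next u) ≡ true
  cycle-next u rewrite distinct-next u | follows-next u = refl

  module Choice (f : Fin (suc p) → Bool) where

    -- The value `f u` decides about the edge from `u` to `next u`; the two disjuncts cover the two
    -- orders in which its ends may be given.
    chosen : EdgeSet (suc p)
    chosen = offDiagonal (λ u v → follows u v ∧ f u ∨ follows v u ∧ f v)
                         (λ u v → ∨-comm (follows u v ∧ f u) (follows v u ∧ f v))

    chosen-next : ∀ u → adj chosen u (next u) ≡ f u
    chosen-next u rewrite distinct-next u | follows-next u | follows-back u = ∨-identityʳ (f u)

    chosen-elim : (P : Fin (suc p) → Fin (suc p) → Set) → (∀ {u v} → P u v → P v u) →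
                  (∀ u → T (f u) → P u (next u)) → ∀ u v → T (adj chosen u v) → P u v
    chosen-elim P P-sym base u v c with T-∨ .to (proj₂ (T-∧ {distinct u v} .to c))
    ... | inj₁ a = let g , fu = T-∧ .to a in subst (P u) (follows⇒next u v g) (base u fu)
    ... | inj₂ a = let g , fv = T-∧ .to a in P-sym (subst (P v) (follows⇒next v u g) (base v fv))

    chosen⊆cycle : ∀ u v → T (adj chosen u v) → T (adj (cycle (suc p)) u v)
    chosen⊆cycle = chosen-elim _ (λ {u} {v} → subst T (symmetric (cycle (suc p)) u v))
                               (λ u _ → T-≡ .from (cycle-next u))

    size-chosen : size chosen ≡ sum (λ u → ind (f u))
    size-chosen = trans (size-in-cycle chosen chosen⊆cycle) (sum-cong-≗ λ u → cong ind (chosen-next u))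

  open Choice using (chosen; chosen-elim; size-chosen)

  -- An edge could lie in both parts only through two orientations whose starting vertices have
  -- different values of `f`, and `follows-asym` leaves one orientation.
  chosen-partition : (f : Fin (suc p) → Bool) → cycle (suc p) ≐ chosen f ⊔ chosen (not ∘ f)
  chosen-partition f = record
    { cover    = λ u v → cover (distinct u v) (follows u v) (follows v u) (f u) (f v)
    ; disjoint = λ u v → disjoint (distinct u v) (follows u v) (follows v u) (f u) (f v) (follows-asym 3≤ℓ u v)
    }
    where
    cover : ∀ d a b x y → d ∧ (a ∨ b) ≡ d ∧ (a ∧ x ∨ b ∧ y) ∨ d ∧ (a ∧ not x ∨ b ∧ not y)
    cover false _     _     _     _     = refl
    cover true  true  _     true  _     = refl
    cover true  true  true  false true  = refl
    cover true  true  true  false false = refl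
    cover true  true  false false _     = refl
    cover true  false true  _     true  = refl
    cover true  false true  _     false = refl
    cover true  false false _     _     = refl
    disjoint : ∀ d a b x y → (T a → ¬ T b) →
               (d ∧ (a ∧ x ∨ b ∧ y)) ∧ (d ∧ (a ∧ not x ∨ b ∧ not y)) ≡ false
    disjoint false _     _     _     _     _   = refl
    disjoint true  true  true  _     _     a⊥b = contradiction tt (a⊥b tt)
    disjoint true  true  false true  _     _   = refl
    disjoint true  true  false false _     _   = refl
    disjoint true  false true  _     true  _   = refl
    disjoint true  false true  _     false _   = refl
    disjoint true  false false _     _     _   = refl

  module _ {n : ℕ} (R B : EdgeSet n) {t : ℕ} (ℓ≡t+t : suc p ≡ t + t) where

    -- Of the `t + t` edges at least `t` may be blue, so at most `t` are forced to be red, while at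
    -- least `t` may be red. Hence `between` finds exactly `t` red edges that include all the forced
    -- ones; the others may all be blue.
    balancedCopy : (φ : Fin (suc p) → Fin n) → (∀ {i j} → φ i ≡ φ j → i ≡ j) →
                   (∀ {u v} → u ≢ v → T (adj R u v ∨ adj B u v)) →
                   t ≤ sum (λ i → ind (adj R (φ i) (φ (next i)))) →
                   t ≤ sum (λ i → ind (adj B (φ i) (φ (next i)))) →
                   BalancedCopy R B (cycle (suc p))
    balancedCopy φ φ-inj covered t≤r t≤b = record
      { φ         = φ
      ; injective = φ-inj
      ; E₁        = chosen f
      ; E₂        = chosen (not ∘ f)
      ; partition = chosen-partition f
      ; E₁⊆R      = chosen-elim f _ (λ {u} {v} → subst T (symmetric R (φ u) (φ v))) λ u → f⊆R
      ; E₂⊆B      = chosen-elim (not ∘ f) _ (λ {u} {v} → subst T (symmetric B (φ u) (φ v))) λ u → notf⊆B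
      ; balanced  = ≤-trans (≤-reflexive (trans (cong₂ ∣_-_∣ size₁ size₂) (∣n-n∣≡0 t))) z≤n
      }
      where
      r b : Fin (suc p) → Bool
      r i = adj R (φ i) (φ (next i))
      b i = adj B (φ i) (φ (next i))
      φ≢ : ∀ i → φ i ≢ φ (next i)
      φ≢ i eq = follows-asym 3≤ℓ i i (fii (φ-inj eq)) (fii (φ-inj eq))
        where
        fii : i ≡ next i → T (follows i i)
        fii e = subst (T ∘ follows i) (sym e) (T-≡ .from (follows-next i))
      not-b⇒r : ∀ i → T (not (b i)) → T (r i)
      not-b⇒r i nb with r i | b i | covered (φ≢ i)
      ... | true | _ | _ = tt
      ... | false | false | ()
      complementary : (g : Fin (suc p) → Bool) → sum (ind ∘ g) + sum (ind ∘ not ∘ g) ≡ t + t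
      complementary g = trans (sym (∑-distrib-+ (ind ∘ g) (ind ∘ not ∘ g)))
        (trans (sum-cong-≗ (ind-not ∘ g)) (trans (sum-const (suc p) 1) (trans (*-identityʳ _) ℓ≡t+t)))
      not-b≤t : sum (ind ∘ not ∘ b) ≤ t
      not-b≤t = +-cancelˡ-≤ t _ _ (≤-trans (+-monoˡ-≤ _ t≤b) (≤-reflexive (complementary b)))
      selection = between (not ∘ b) r not-b⇒r not-b≤t t≤r
      f = proj₁ selection
      f⊆R : ∀ {i} → T (f i) → T (r i)
      f⊆R = proj₁ (proj₂ (proj₂ selection)) _
      notf⊆B : ∀ {i} → T (not (f i)) → T (b i)
      notf⊆B {i} nf with b i | f i | proj₁ (proj₂ selection) i
      ... | true  | _     | _ = tt
      ... | false | false | h = h tt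
      size₁ : size (chosen f) ≡ t
      size₁ = trans (size-chosen f) (proj₂ (proj₂ (proj₂ selection)))
      size₂ : size (chosen (not ∘ f)) ≡ t
      size₂ = trans (size-chosen (not ∘ f)) (+-cancelˡ-≡ t _ _
        (trans (cong (_+ sum (ind ∘ not ∘ f)) (sym (proj₂ (proj₂ (proj₂ selection))))) (complementary f)))

    -- With `a < t` edges in `E₁` there would be at most `a + 1` in `E₂`, hence fewer than `t + t`
    -- in total. So the tolerance of 1 allows no loss on a cycle of even length.
    balanced-half : (copy : BalancedCopy R B (cycle (suc p))) → let open BalancedCopy copy in
                    t ≤ sum (λ i → ind (adj R (φ i) (φ (next i))))
    balanced-half copy = begin
      t                                              ≤⟨ half total balanced ⟩
      size E₁                                        ≡⟨ size-in-cycle E₁ (λ u v → part⊆ _ _ (cover u v) ∘ inj₁) ⟩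
      sum (λ i → ind (adj E₁ i (next i)))            ≤⟨ sum-mono (λ i → ind-mono (E₁⊆R i (next i))) ⟩
      sum (λ i → ind (adj R (φ i) (φ (next i))))     ∎
      where
      open ≤-Reasoning
      open BalancedCopy copy
      open _≐_⊔_ partition
      part⊆ : ∀ {c} a b → c ≡ a ∨ b → T a ⊎ T b → T c
      part⊆ a b eq ab = subst T (sym eq) (T-∨ .from ab)
      one : ∀ {c} a b → c ≡ true → c ≡ a ∨ b → a ∧ b ≡ false → ind a + ind b ≡ 1
      one true  true  _ _ ()
      one true  false _ _ _ = refl
      one false true  _ _ _ = refl
      one false false refl () _
      total : size E₁ + size E₂ ≡ t + t
      total = trans (cong₂ _+_ (size-in-cycle E₁ λ u v → part⊆ _ _ (cover u v) ∘ inj₁)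
                               (size-in-cycle E₂ λ u v → part⊆ (adj E₁ u v) _ (cover u v) ∘ inj₂))
        (trans (sym (∑-distrib-+ (λ i → ind (adj E₁ i (next i))) (λ i → ind (adj E₂ i (next i)))))
        (trans (sum-cong-≗ λ i → one (adj E₁ i (next i)) (adj E₂ i (next i)) (cycle-next i) (cover i (next i)) (disjoint i (next i)))
        (trans (sum-const (suc p) 1) (trans (*-identityʳ _) ℓ≡t+t))))
      half : ∀ {a b} → a + b ≡ t + t → ∣ a - b ∣ ≤ 1 → t ≤ a
      half {a} {b} a+b≡t+t near = ≮⇒≥ λ a<t → <-irrefl refl (begin-strict
        t + t          ≡⟨ a+b≡t+t ⟨
        a + b          ≤⟨ +-monoʳ-≤ a (≤-trans (m≤n+∣n-m∣ b a) (+-monoʳ-≤ a near)) ⟩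
        a + (a + 1)    ≡⟨ cong (a +_) (+-comm a 1) ⟩
        a + suc a      <⟨ +-mono-<-≤ a<t a<t ⟩
        t + t          ∎)

-- Cycles as lists of vertices

Unique-↭ : ∀ {A : Set} {xs ys : List A} → xs ↭ ys → Unique xs → Unique ys
Unique-↭ {A} = Permutation.Unique-resp-↭ (setoid A) ∘ ↭⇒↭ₛ

∉⇒All≢ : ∀ {A : Set} {x : A} {xs} → x ∉ xs → All (x ≢_) xs
∉⇒All≢ x∉xs = All.tabulate λ y∈xs x≡y → x∉xs (subst (_∈ _) (sym x≡y) y∈xs)

Unique-lookup : ∀ {A : Set} {xs : List A} → Unique xs → ∀ {i j} → lookup xs i ≡ lookup xs j → i ≡ j
Unique-lookup (x≢ ∷ u) {zero}  {zero}  _  = refl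
Unique-lookup (x≢ ∷ u) {zero}  {suc j} eq = contradiction eq (All.lookup x≢ (∈-lookup j))
Unique-lookup (x≢ ∷ u) {suc i} {zero}  eq = contradiction (sym eq) (All.lookup x≢ (∈-lookup i))
Unique-lookup (x≢ ∷ u) {suc i} {suc j} eq = cong suc (Unique-lookup u eq)

module _ {V : Set} (r : V → V → Bool) where

  walk : V → List V → V → ℕ
  walk u []       v = ind (r u v)
  walk u (x ∷ xs) v = ind (r u x) + walk x xs v

  closed : List V → ℕ
  closed []       = 0
  closed (x ∷ xs) = walk x xs x

  walk-++ : ∀ u xs y ys v → walk u (xs ++ y ∷ ys) v ≡ walk u xs y + walk y ys v
  walk-++ u []       y ys v = refl
  walk-++ u (x ∷ xs) y ys v =
    trans (cong (ind (r u x) +_) (walk-++ x xs y ys v)) (sym (+-assoc (ind (r u x)) _ _))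

  -- The heads of the two lists cut the cycle into two walks, whose counts commute. Any vertex may
  -- therefore be brought to the head before it is replaced.
  closed-rotate : ∀ xs ys → closed (xs ++ ys) ≡ closed (ys ++ xs)
  closed-rotate []       ys = cong closed (sym (++-identityʳ ys))
  closed-rotate (x ∷ xs) [] = cong (λ zs → closed (x ∷ zs)) (++-identityʳ xs)
  closed-rotate (x ∷ xs) (y ∷ ys) =
    trans (walk-++ x xs y ys x) (trans (+-comm _ (walk y ys x)) (sym (walk-++ y ys x xs y)))

  walk-tabulate : ∀ {p} (f : Fin (suc p) → V) v →
    walk (f zero) (tabulate (f ∘ suc)) v
      ≡ sum {p} (λ i → ind (r (f (inject₁ i)) (f (suc i)))) + ind (r (f (fromℕ p)) v)
  walk-tabulate {zero}  f v = refl
  walk-tabulate {suc p} f v =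
    trans (cong (ind (r (f zero) (f (suc zero))) +_) (walk-tabulate (f ∘ suc) v))
          (sym (+-assoc (ind (r (f zero) (f (suc zero)))) _ _))

  -- Connects cycles as lists with copies given by a map on `Fin`. The last index is split off, as
  -- `next` wraps around there.
  closed-tabulate : ∀ {p} (f : Fin (suc p) → V) →
    closed (tabulate f) ≡ sum (λ i → ind (r (f i) (f (next i))))
  closed-tabulate {p} f = begin
    walk (f zero) (tabulate (f ∘ suc)) (f zero)
      ≡⟨ walk-tabulate f (f zero) ⟩
    sum {p} (λ i → ind (r (f (inject₁ i)) (f (suc i)))) + ind (r (f (fromℕ p)) (f zero))
      ≡⟨ cong₂ _+_ (sum-cong-≗ λ i → cong (λ j → ind (r (f (inject₁ i)) (f j))) (next-inject₁ i))
                   (cong (λ j → ind (r (f (fromℕ p)) (f j))) (next-fromℕ p)) ⟨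
    sum {p} (λ i → t (inject₁ i)) + t (fromℕ p)
      ≡⟨ sum-init-last t ⟨
    sum t ∎
    where
    open ≡-Reasoning
    t : Fin (suc p) → ℕ
    t i = ind (r (f i) (f (next i)))

walk-cong : ∀ {V : Set} {r s : V → V → Bool} → (∀ u v → r u v ≡ s u v) →
            ∀ u xs v → walk r u xs v ≡ walk s u xs v
walk-cong r≡s u []       v = cong ind (r≡s u v)
walk-cong r≡s u (x ∷ xs) v = cong₂ _+_ (cong ind (r≡s u x)) (walk-cong r≡s x xs v)

closed-cong : ∀ {V : Set} {r s : V → V → Bool} → (∀ u v → r u v ≡ s u v) →
              ∀ xs → closed r xs ≡ closed s xs
closed-cong r≡s []       = refl
closed-cong r≡s (x ∷ xs) = walk-cong r≡s x xs x

-- In a complete graph any list of `ℓ` distinct vertices is a copy of the cycle (for `ℓ` at least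
-- 3), the last vertex being joined to the first. Colours enter through `P` alone.
record CycleWith {n : ℕ} (ℓ : ℕ) (P : List (Fin n) → Set) : Set where
  constructor cyc
  field
    vertices : List (Fin n)
    order    : length vertices ≡ ℓ
    unique   : Unique vertices
    property : P vertices

Rich : ∀ {n} → ℕ → ℕ → EdgeSet n → Set
Rich ℓ t E = CycleWith ℓ λ vs → t ≤ closed (adj E) vs

cycle⇒balanced : ∀ {n} (R B : EdgeSet n) → (∀ {u v} → u ≢ v → T (adj R u v ∨ adj B u v)) →
  ∀ {ℓ t} → 3 ≤ ℓ → ℓ ≡ t + t →
  CycleWith ℓ (λ vs → t ≤ closed (adj R) vs × t ≤ closed (adj B) vs) → BalancedCopy R B (cycle ℓ)
cycle⇒balanced R B covered 3≤ℓ eq (cyc (v ∷ vs) refl unique (t≤r , t≤b)) =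
  CycleGraph.balancedCopy 3≤ℓ R B eq φ (Unique-lookup unique) covered (count R t≤r) (count B t≤b)
  where
  φ = lookup (v ∷ vs)
  count : ∀ E {t} → t ≤ closed (adj E) (v ∷ vs) → t ≤ sum (λ i → ind (adj E (φ i) (φ (next i))))
  count E t≤ = ≤-trans t≤ (≤-reflexive
    (trans (cong (closed (adj E)) (sym (tabulate-lookup (v ∷ vs)))) (closed-tabulate (adj E) φ)))

balanced⇒rich : ∀ {n} (R B : EdgeSet n) {ℓ t} → 3 ≤ ℓ → ℓ ≡ t + t → BalancedCopy R B (cycle ℓ) → Rich ℓ t R
balanced⇒rich R B {ℓ = suc p} 3≤ℓ eq copy =
  cyc (tabulate φ) (length-tabulate φ) (Unique.tabulate⁺ injective)
      (≤-trans (CycleGraph.balanced-half 3≤ℓ R B eq copy) (≤-reflexive (sym (closed-tabulate (adj R) φ))))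
  where open BalancedCopy copy

-- Replacing one vertex of a cycle

mult : ∀ {n} → Fin n → List (Fin n) → ℕ
mult z []       = 0
mult z (x ∷ xs) = ind (does (x ≟ z)) + mult z xs

sum-mult : ∀ {n} (f : Fin n → ℕ) xs → sum (λ z → mult z xs * f z) ≡ sumᴸ (map f xs)
sum-mult f []       = sum-zero {f = λ z → mult z [] * f z} λ _ → refl
sum-mult f (x ∷ xs) = begin
  sum (λ z → (ind (does (x ≟ z)) + mult z xs) * f z)
    ≡⟨ sum-cong-≗ (λ z → *-distribʳ-+ (f z) (ind (does (x ≟ z))) (mult z xs)) ⟩
  sum (λ z → ind (does (x ≟ z)) * f z + mult z xs * f z)
    ≡⟨ ∑-distrib-+ (λ z → ind (does (x ≟ z)) * f z) (λ z → mult z xs * f z) ⟩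
  sum (λ z → ind (does (x ≟ z)) * f z) + sum (λ z → mult z xs * f z)
    ≡⟨ cong₂ _+_ (sum-≟ f x) (sum-mult f xs) ⟩
  f x + sumᴸ (map f xs) ∎
  where open ≡-Reasoning

∈⇒mult≥1 : ∀ {n} {z : Fin n} {xs} → z ∈ xs → 1 ≤ mult z xs
∈⇒mult≥1 {z = z} (here refl) rewrite dec-true (z ≟ z) refl = s≤s z≤n
∈⇒mult≥1 {xs = x ∷ xs} (there z∈) = ≤-trans (∈⇒mult≥1 z∈) (m≤n+m _ _)

∉⇒mult≡0 : ∀ {n} {z : Fin n} {xs} → z ∉ xs → mult z xs ≡ 0
∉⇒mult≡0 {xs = []} _ = refl
∉⇒mult≡0 {z = z} {x ∷ xs} z∉
  rewrite dec-false (x ≟ z) (z∉ ∘ here ∘ sym) = ∉⇒mult≡0 (z∉ ∘ there)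

Unique⇒mult≤1 : ∀ {n} {z : Fin n} {xs} → Unique xs → mult z xs ≤ 1
Unique⇒mult≤1 [] = z≤n
Unique⇒mult≤1 {z = z} {x ∷ xs} u@(_ ∷ u′) with x ≟ z
... | yes refl rewrite ∉⇒mult≡0 (Unique.Unique[x∷xs]⇒x∉xs u) = ≤-refl
... | no _ = Unique⇒mult≤1 u′

module _ {n : ℕ} where
  open import Data.List.Membership.DecPropositional (_≟_ {n}) public using (_∈?_)

sumᴸ-≤ : ∀ {A : Set} {f : A → ℕ} {c xs} → All (λ x → f x ≤ c) xs → sumᴸ (map f xs) ≤ length xs * c
sumᴸ-≤ []         = z≤n
sumᴸ-≤ (fx≤c ∷ a) = +-mono-≤ fx≤c (sumᴸ-≤ a)

-- Pigeonhole: if all of `S` occurred in `xs`, multiplicities in `xs` would dominate the indicator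
-- of `S`, and they add up to the length of `xs`.
choose : ∀ {n} (S : Fin n → Bool) xs → length xs < sum (ind ∘ S) → ∃[ z ] T (S z) × z ∉ xs
choose S xs xs<S with Fin.any? (λ z → T? (S z) ×-dec ¬? (z ∈? xs))
... | yes found = found
... | no none = contradiction xs<S (≤⇒≯ (begin
    sum (ind ∘ S)                     ≤⟨ sum-mono (λ z → bound z (S z) (λ s → none ∘ (z ,_) ∘ (s ,_))) ⟩
    sum (λ z → mult z xs * 1)         ≡⟨ sum-mult (λ _ → 1) xs ⟩
    sumᴸ (map (λ _ → 1) xs)           ≤⟨ sumᴸ-≤ {c = 1} {xs} (All.tabulate λ _ → ≤-refl) ⟩
    length xs * 1                     ≡⟨ *-identityʳ _ ⟩
    length xs                         ∎))
  where
  open ≤-Reasoning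
  bound : ∀ z s → (T s → ¬ z ∉ xs) → ind s ≤ mult z xs * 1
  bound z false _ = z≤n
  bound z true  h with z ∈? xs
  ... | yes z∈ = ≤-trans (∈⇒mult≥1 z∈) (≤-reflexive (sym (*-identityʳ _)))
  ... | no z∉ = contradiction z∉ (h tt)

fresh : ∀ {n} (xs : List (Fin n)) → length xs < n → ∃[ z ] z ∉ xs
fresh {n} xs xs<n = let z , _ , z∉ = choose (λ _ → true) xs (subst (length xs <_) (sym total) xs<n) in z , z∉
  where
  total : sum {n} (λ _ → 1) ≡ n
  total = trans (sum-const n 1) (*-identityʳ n)

module _ {A : Set} where

  ∉-insert : ∀ {w z : A} X {Y} → w ≢ z → w ∉ X ++ Y → w ∉ X ++ z ∷ Y
  ∉-insert {z = z} X w≢z w∉ w∈ with ∈-resp-↭ (shift z X _) w∈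
  ... | here w≡z = w≢z w≡z
  ... | there w∈′ = w∉ w∈′

  Unique⇒∉ : ∀ {w : A} X {Y} → Unique (X ++ w ∷ Y) → w ∉ X ++ Y
  Unique⇒∉ {w} X u = Unique.Unique[x∷xs]⇒x∉xs (Unique-↭ (shift w X _) u)

  Unique-replace : ∀ {v z : A} X {Y} → Unique (X ++ v ∷ Y) → z ∉ X ++ v ∷ Y → Unique (X ++ z ∷ Y)
  Unique-replace {v} {z} X {Y} u z∉ with Unique-↭ (shift v X Y) u
  ... | _ ∷ u′ = Unique-↭ (↭-sym (shift z X Y))
    (∉⇒All≢ (λ z∈ → z∉ (∈-resp-↭ (↭-sym (shift v X Y)) (there z∈))) ∷ u′)

  length-replace : ∀ {v z : A} X {Y} → length (X ++ v ∷ Y) ≡ length (X ++ z ∷ Y)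
  length-replace X {Y} = trans (length-++ X) (sym (length-++ X))

odd : ℕ → Bool
odd zero    = false
odd (suc n) = not (odd n)

odd-ind-+ : ∀ b n → odd (ind b + n) ≡ b xor odd n
odd-ind-+ true  n = refl
odd-ind-+ false n = refl

odd-double : ∀ n → odd (n + n) ≡ false
odd-double zero    = refl
odd-double (suc n) rewrite +-suc n n | odd-double n = refl

-- Two cycles that differ in one vertex occupy `suc ℓ` vertices; `room` guarantees a further vertex
-- off both.
module Switching {n : ℕ} (r : Fin n → Fin n → Bool) (r-sym : ∀ u v → r u v ≡ r v u)
                 {ℓ t : ℕ} (room : suc ℓ < n) (3≤ℓ : 3 ≤ ℓ) (odd-ℓ : odd ℓ ≡ false) (odd-t : odd t ≡ false) where

  Balanced : Set
  Balanced = CycleWith ℓ λ vs → closed r vs ≡ t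

  -- If replacing one vertex by z changed a cycle's count by exactly one, then, performed in
  -- the cycle through x or in the one through y, it would yield a count of exactly t.
  module Jump {x y z : Fin n} {P : List (Fin n)} {W : ℕ}
    (order : length (x ∷ P) ≡ ℓ) (ux : Unique (x ∷ P)) (uy : Unique (y ∷ P))
    (W+1 : suc W ≡ t) (cx : closed r (x ∷ P) ≡ W) (cy : closed r (y ∷ P) ≡ 2 + W)
    (z∉ : z ∉ x ∷ y ∷ P) where

    -- Both sums lie in {0, 1, 2}, where numbers of different parity are consecutive.
    parity-or-step : ∀ p q p′ q′ → p xor q ≡ p′ xor q′
              ⊎ ind p′ + ind q′ ≡ suc (ind p + ind q) ⊎ suc (ind p′ + ind q′) ≡ ind p + ind q
    parity-or-step false false false false = inj₁ refl
    parity-or-step false false false true  = inj₂ (inj₁ refl)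
    parity-or-step false false true  false = inj₂ (inj₁ refl)
    parity-or-step false false true  true  = inj₁ refl
    parity-or-step false true  false false = inj₂ (inj₂ refl)
    parity-or-step false true  false true  = inj₁ refl
    parity-or-step false true  true  false = inj₁ refl
    parity-or-step false true  true  true  = inj₂ (inj₁ refl)
    parity-or-step true  false false false = inj₂ (inj₂ refl)
    parity-or-step true  false false true  = inj₁ refl
    parity-or-step true  false true  false = inj₁ refl
    parity-or-step true  false true  true  = inj₂ (inj₁ refl)
    parity-or-step true  true  false false = inj₁ refl
    parity-or-step true  true  false true  = inj₂ (inj₂ refl)
    parity-or-step true  true  true  false = inj₂ (inj₂ refl)
    parity-or-step true  true  true  true  = inj₁ refl

    z∉x : z ∉ x ∷ P
    z∉x (here e)   = z∉ (here e)
    z∉x (there z∈) = z∉ (there (there z∈))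

    z∉y : z ∉ y ∷ P
    z∉y = z∉ ∘ there

    through : Fin n → List (Fin n) → Fin n → Fin n → Fin n → List (Fin n) → ℕ
    through v X p q s Y = walk r v X p + (ind (r p q) + ind (r q s) + walk r s Y v)

    closed-through : ∀ v X p q s Y → closed r (v ∷ X ++ p ∷ q ∷ s ∷ Y) ≡ through v X p q s Y
    closed-through v X p q s Y =
      trans (walk-++ r v X p (q ∷ s ∷ Y) v) (cong (walk r v X p +_) (sym (+-assoc (ind (r p q)) _ _)))

    swapped : ∀ v X p q s Y → P ≡ X ++ p ∷ q ∷ s ∷ Y → length (v ∷ P) ≡ ℓ → Unique (v ∷ P) → z ∉ v ∷ P →
              through v X p z s Y ≡ t → Balanced
    swapped v X p q s Y eq len u z∉v c = cyc (v ∷ X ++ p ∷ z ∷ s ∷ Y)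
      (trans (cong suc (trans (trans (cong length (sym (++-assoc X [ p ] _)))
                 (trans (length-replace (X ++ [ p ])) (cong length (++-assoc X [ p ] _)))) (cong length (sym eq)))) len)
      (subst Unique (cong (v ∷_) (++-assoc X [ p ] _))
        (Unique-replace (v ∷ X ++ [ p ]) (subst Unique (cong (v ∷_) P≡) u) (z∉v ∘ subst (z ∈_) (cong (v ∷_) (sym P≡)))))
      (trans (closed-through v X p z s Y) c)
      where
      P≡ : P ≡ (X ++ [ p ]) ++ q ∷ s ∷ Y
      P≡ = trans eq (sym (++-assoc X [ p ] _))

    -- A gain of one is applied to the cycle through `x`, which has `W` red edges, and a loss of one
    -- to the cycle through `y`, which has `2 + W`. Either way the count becomes `suc W`, that is
    -- `t`.
    local : ∀ X p q s Y → P ≡ X ++ p ∷ q ∷ s ∷ Y →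
            Balanced ⊎ r p q xor r q s ≡ r p z xor r z s
    local X p q s Y eq with parity-or-step (r p q) (r q s) (r p z) (r z s)
    ... | inj₁ same = inj₂ same
    ... | inj₂ (inj₁ up) = inj₁ (swapped x X p q s Y eq order ux z∉x (begin
        through x X p z s Y           ≡⟨ cong (λ c → walk r x X p + (c + walk r s Y x)) up ⟩
        walk r x X p + suc _          ≡⟨ +-suc (walk r x X p) _ ⟩
        suc (through x X p q s Y)     ≡⟨ cong suc (closed-through x X p q s Y) ⟨
        suc (closed r (x ∷ X ++ p ∷ q ∷ s ∷ Y)) ≡⟨ cong (λ L → suc (closed r (x ∷ L))) eq ⟨
        suc (closed r (x ∷ P))        ≡⟨ cong suc cx ⟩
        suc W                         ≡⟨ W+1 ⟩
        t                             ∎))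
      where open ≡-Reasoning
    ... | inj₂ (inj₂ down) = inj₁ (swapped y X p q s Y eq order uy z∉y (suc-injective (begin
        suc (through y X p z s Y)     ≡⟨ +-suc (walk r y X p) _ ⟨
        walk r y X p + suc _          ≡⟨ cong (λ c → walk r y X p + (c + walk r s Y y)) down ⟩
        through y X p q s Y           ≡⟨ closed-through y X p q s Y ⟨
        closed r (y ∷ X ++ p ∷ q ∷ s ∷ Y) ≡⟨ cong (λ L → closed r (y ∷ L)) eq ⟨
        closed r (y ∷ P)              ≡⟨ cy ⟩
        2 + W                         ≡⟨ cong suc W+1 ⟩
        suc t                         ∎)))
      where open ≡-Reasoning

    -- The path is traversed two edges at a time, so only every second vertex is exchanged for `z`.
    -- Each intermediate `s` ends one block and starts the next, whence the colour of its edge to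
    -- `z` cancels and only the two ends remain. The odd number of inner vertices makes the last
    -- block stop at `b`.
    telescope : ∀ X p N b → P ≡ X ++ p ∷ N ++ [ b ] → odd (length N) ≡ true →
                Balanced ⊎ odd (walk r p N b) ≡ r p z xor r z b
    telescope X p (q ∷ []) b eq _ with local X p q b [] eq
    ... | inj₁ bal  = inj₁ bal
    ... | inj₂ same = inj₂ (trans (odd-ind-+ (r p q) _) (trans (cong (r p q xor_) (odd-ind (r q b))) same))
      where
      odd-ind : ∀ c → odd (ind c) ≡ c
      odd-ind true  = refl
      odd-ind false = refl
    telescope X p (q ∷ s ∷ N) b eq oddN
      with local X p q s (N ++ [ b ]) eq
         | telescope (X ++ p ∷ q ∷ []) s N b (trans eq (sym (++-assoc X (p ∷ q ∷ []) _)))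
                     (trans (sym (not-involutive _)) oddN)
    ... | inj₁ bal  | _         = inj₁ bal
    ... | _         | inj₁ bal  = inj₁ bal
    ... | inj₂ same | inj₂ rest = inj₂ (begin
        odd (ind (r p q) + (ind (r q s) + walk r s N b))
          ≡⟨ trans (odd-ind-+ (r p q) _) (cong (r p q xor_) (odd-ind-+ (r q s) _)) ⟩
        r p q xor (r q s xor odd (walk r s N b))
          ≡⟨ xor-assoc (r p q) (r q s) _ ⟨
        (r p q xor r q s) xor odd (walk r s N b)
          ≡⟨ cong₂ _xor_ same (trans rest (cong (_xor r z b) (r-sym s z))) ⟩
        (r p z xor r z s) xor (r z s xor r z b)
          ≡⟨ cancel (r p z) (r z s) (r z b) ⟩
        r p z xor r z b ∎)
      where
      open ≡-Reasoning
      cancel : ∀ c d e → (c xor d) xor (d xor e) ≡ c xor e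
      cancel true  true  e = refl
      cancel true  false e = refl
      cancel false true  true  = refl
      cancel false true  false = refl
      cancel false false e = refl

    balanced : ∀ a M b → P ≡ a ∷ M ++ [ b ] → walk r a M b ≡ W → Balanced
    balanced a M b P≡ W≡ with telescope [] a M b P≡ oddM
      where
      triple-not : ∀ c → not (not (not c)) ≡ false → c ≡ true
      triple-not true  _ = refl
      triple-not false ()
      len : 3 + length M ≡ ℓ
      len = trans (cong (2 +_) (trans (+-comm 1 (length M)) (sym (length-++ M))))
                  (trans (cong suc (cong length (sym P≡))) order)
      oddM : odd (length M) ≡ true
      -- The cycle consists of `M`, the two ends of the path and one closing vertex: `ℓ` is
      -- `3 + length M`, and it is even.
      oddM = triple-not _ (trans (cong odd len) odd-ℓ)
    ... | inj₁ bal = bal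
    ... | inj₂ par = through-z (r z a) (r b z) refl refl
          (trans (cong odd (sym W≡)) (trans par (cong₂ _xor_ (r-sym a z) (r-sym z b))))
      where
      at-z : ∀ {c d} → r z a ≡ c → r b z ≡ d → ind c + (W + ind d) ≡ t → Balanced
      at-z za bz eq = cyc (z ∷ P) order (∉⇒All≢ (z∉x ∘ there) ∷ AllPairs.tail ux) (begin
        closed r (z ∷ P)                            ≡⟨ cong (λ L → closed r (z ∷ L)) P≡ ⟩
        walk r z (a ∷ M ++ [ b ]) z                 ≡⟨ cong (ind (r z a) +_) (walk-++ r a M b [] z) ⟩
        ind (r z a) + (walk r a M b + ind (r b z))  ≡⟨ cong₂ (λ c s → ind c + s) za (cong₂ (λ w d → w + ind d) W≡ bz) ⟩
        _                                           ≡⟨ eq ⟩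
        t                                           ∎)
        where open ≡-Reasoning
      oddW : ∀ {c} → odd W ≡ c → c ≡ true
      oddW refl = negated (odd W) (trans (cong odd W+1) odd-t)
        where
        negated : ∀ c → not c ≡ false → c ≡ true
        negated true _ = refl
      through-z : ∀ c d → r z a ≡ c → r b z ≡ d → odd W ≡ r z a xor r b z → Balanced
      through-z true  false za bz _ = at-z za bz (trans (cong suc (+-identityʳ W)) W+1)
      through-z false true  za bz _ = at-z za bz (trans (+-comm W 1) W+1)
      -- Closing edges of equal colour would make `W` even, but `suc W` is the even number `t`.
      through-z true  true  za bz odd≡ = contradiction (oddW (trans odd≡ (cong₂ _xor_ za bz))) λ ()
      through-z false false za bz odd≡ = contradiction (oddW (trans odd≡ (cong₂ _xor_ za bz))) λ ()

  Above : List (Fin n) → Set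
  Above vs = length vs ≡ ℓ × Unique vs × t < closed r vs

  rotate : ∀ X Y → Above (X ++ Y) → Above (Y ++ X)
  rotate X Y (len , u , t<c) =
    trans (↭-length (++-comm Y X)) len , Unique-↭ (++-comm X Y) u , subst (t <_) (closed-rotate r X Y) t<c

  -- Both cycles contain the path `P` with its `W` red edges and add at most two to them. A drop
  -- from above `t` to below `t` thus leaves only the counts `2 + W` and `W` with `suc W` equal to
  -- `t`, which is the situation of `Jump`.
  replace-head : ∀ {y x} P → Above (y ∷ P) → x ∉ y ∷ P → Balanced ⊎ Above (x ∷ P)
  replace-head [] (len , _) _ = contradiction (subst (3 ≤_) (sym len) 3≤ℓ) λ { (s≤s ()) }
  replace-head (a ∷ P′) _ _ with initLast P′
  replace-head (a ∷ .[]) (len , _) _ | [] = contradiction (subst (3 ≤_) (sym len) 3≤ℓ) λ { (s≤s (s≤s ())) }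
  replace-head {y} {x} (a ∷ .(M ∷ʳ b)) (len , uy@(_ ∷ uP) , t<cy) x∉ | M ∷ʳ′ b =
    split (<-cmp (closed r (x ∷ P)) t)
    where
    open ≤-Reasoning
    P = a ∷ M ++ [ b ]
    W = walk r a M b
    ux : Unique (x ∷ P)
    ux = ∉⇒All≢ (x∉ ∘ there) ∷ uP
    ends : ∀ v → closed r (v ∷ P) ≡ ind (r v a) + (W + ind (r b v))
    ends v = cong (ind (r v a) +_) (walk-++ r a M b [] v)
    cy≤ : closed r (y ∷ P) ≤ 2 + W
    cy≤ = begin
      closed r (y ∷ P)                 ≡⟨ ends y ⟩
      ind (r y a) + (W + ind (r b y))  ≤⟨ +-mono-≤ (ind≤1 (r y a)) (+-monoʳ-≤ W (ind≤1 (r b y))) ⟩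
      1 + (W + 1)                      ≡⟨ cong suc (+-comm W 1) ⟩
      2 + W                            ∎
    W≤cx : W ≤ closed r (x ∷ P)
    W≤cx = begin
      W                                ≤⟨ m≤m+n W _ ⟩
      W + ind (r b x)                  ≤⟨ m≤n+m _ (ind (r x a)) ⟩
      ind (r x a) + (W + ind (r b x))  ≡⟨ ends x ⟨
      closed r (x ∷ P)                 ∎
    split : Tri _ _ _ → Balanced ⊎ Above (x ∷ P)
    split (tri≈ _ c≡t _) = inj₁ (cyc (x ∷ P) len ux c≡t)
    split (tri> _ _ t<c) = inj₂ (len , ux , t<c)
    split (tri< c<t _ _) with fresh (x ∷ y ∷ P) (subst (λ m → suc m < n) (sym len) room)
    ... | z , z∉ = inj₁ (Jump.balanced len ux uy W+1
            (≤-antisym (s≤s⁻¹ (subst (closed r (x ∷ P) <_) (sym W+1) c<t)) W≤cx)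
            (≤-antisym cy≤ (≤-trans (s≤s (≤-reflexive W+1)) t<cy)) z∉ a M b refl refl)
      where
      W+1 : suc W ≡ t
      W+1 = ≤-antisym (≤-<-trans W≤cx c<t) (s≤s⁻¹ (≤-trans t<cy cy≤))

  replace : ∀ X {y x} Y → Above (X ++ y ∷ Y) → x ∉ X ++ y ∷ Y → Balanced ⊎ Above (X ++ x ∷ Y)
  replace X {y} {x} Y above x∉ with replace-head (Y ++ X) (rotate X (y ∷ Y) above)
                                      (x∉ ∘ ∈-resp-↭ (++-comm (y ∷ Y) X))
  ... | inj₁ bal = inj₁ bal
  ... | inj₂ above′ = inj₂ (rotate (x ∷ Y) X above′)

  -- Vertices are exchanged from left to right; `ds` is the prefix that already agrees with the
  -- target.
  transform : ∀ ds vs ws → Above (ds ++ vs) → Unique (ds ++ ws) → length vs ≡ length ws →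
              Balanced ⊎ Above (ds ++ ws)
  transform ds []       []       above _ _ = inj₂ above
  transform ds (v ∷ vs) (w ∷ ws) above u len = dispatch (v ≟ w) (w ∈? vs)
    where
    w∉ds : w ∉ ds
    w∉ds w∈ = Unique⇒∉ ds u (∈-++⁺ˡ w∈)
    continue : ∀ vs → Above (ds ++ w ∷ vs) → length vs ≡ length ws → Balanced ⊎ Above (ds ++ w ∷ ws)
    continue vs above len with transform (ds ++ [ w ]) vs ws (subst Above (sym (++-assoc ds [ w ] vs)) above)
                                         (subst Unique (sym (++-assoc ds [ w ] ws)) u) len
    ... | inj₁ bal = inj₁ bal
    ... | inj₂ above′ = inj₂ (subst Above (++-assoc ds [ w ] ws) above′)
    place : ∀ vs → Above (ds ++ v ∷ vs) → length vs ≡ length ws → w ∉ ds ++ v ∷ vs →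
            Balanced ⊎ Above (ds ++ w ∷ ws)
    place vs above len w∉ with replace ds vs above w∉
    ... | inj₁ bal = inj₁ bal
    ... | inj₂ above′ = continue vs above′ len
    dispatch : Dec (v ≡ w) → Dec (w ∈ vs) → Balanced ⊎ Above (ds ++ w ∷ ws)
    dispatch (yes refl) _ = continue vs above (suc-injective len)
    dispatch (no v≢w) (no w∉vs) = place vs above (suc-injective len) (avoid ∘ ∈-++⁻ ds)
      where
      avoid : ¬ (w ∈ ds ⊎ w ∈ v ∷ vs)
      avoid (inj₁ w∈) = w∉ds w∈
      avoid (inj₂ (here w≡v)) = v≢w (sym w≡v)
      avoid (inj₂ (there w∈)) = w∉vs w∈
    -- The target vertex w sits at a later position: a fresh vertex z takes over that position first.
    dispatch (no v≢w) (yes w∈vs) with ∈-∃++ w∈vs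
    ... | A , B , refl with fresh (ds ++ v ∷ A ++ w ∷ B) (<-trans (subst (_< suc ℓ) (sym (proj₁ above)) ≤-refl) room)
    ...   | z , z∉ with replace (ds ++ v ∷ A) B (subst Above (sym (assoc w)) above) (z∉ ∘ subst (z ∈_) (assoc w))
      where
      assoc : ∀ u → (ds ++ v ∷ A) ++ u ∷ B ≡ ds ++ v ∷ A ++ u ∷ B
      assoc u = ++-assoc ds (v ∷ A) (u ∷ B)
    ...     | inj₁ bal = inj₁ bal
    ...     | inj₂ above′ = place (A ++ z ∷ B) (subst Above (++-assoc ds (v ∷ A) (z ∷ B)) above′)
                (trans (length-replace A) (suc-injective len))
                (subst (w ∉_) (++-assoc ds (v ∷ A) (z ∷ B))
                  (∉-insert (ds ++ v ∷ A)
                    (λ w≡z → z∉ (subst (_∈ ds ++ v ∷ A ++ w ∷ B) w≡z (∈-++⁺ʳ ds (there w∈vs))))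
                    (Unique⇒∉ (ds ++ v ∷ A) (subst Unique (sym (++-assoc ds (v ∷ A) (w ∷ B))) (proj₁ (proj₂ above))))))

  connect : ∀ {us} → Above us → ∀ {ws} → length ws ≡ ℓ → Unique ws → Balanced ⊎ Above ws
  connect {us} above {ws} len u = transform [] us ws above u (trans (proj₁ above) (sym len))

-- Dense graphs have rich cycles

extend : ∀ {n} m (xs : List (Fin n)) → Unique xs → length xs + m ≤ n →
         ∃[ ys ] Unique (xs ++ ys) × length (xs ++ ys) ≡ length xs + m
extend zero    xs u _ = [] , subst Unique (sym (++-identityʳ xs)) u ,
                             trans (cong length (++-identityʳ xs)) (sym (+-identityʳ _))
extend {n} (suc m) xs u room
  with ys , u′ , len ← extend m xs u (≤-trans (+-monoʳ-≤ (length xs) (n≤1+n m)) room)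
  with z , z∉ ← fresh (xs ++ ys) (subst (_≤ n) (trans (+-suc (length xs) m) (cong suc (sym len))) room)
  = z ∷ ys , Unique-↭ (↭-sym (shift z xs ys)) (∉⇒All≢ z∉ ∷ u′) ,
    trans (length-++-sucʳ xs z ys) (trans (cong suc len) (sym (+-suc (length xs) m)))

module _ {n : ℕ} (E : EdgeSet n) where

  private r = adj E

  degree : Fin n → ℕ
  degree u = sum λ v → ind (r u v)

  degree≤n : ∀ u → degree u ≤ n
  degree≤n u = ≤-trans (sum-mono λ v → ind≤1 (r u v)) (≤-reflexive (trans (sum-const n 1) (*-identityʳ n)))

  -- A bound that holds for all outer neighbours `u` and `v` concerns the edges inside `xs`, so it
  -- survives when the list is continued and closed to a cycle.
  Contains : ℕ → List (Fin n) → Set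
  Contains m xs = ∀ u v → m ≤ walk r u xs v

  Contains-++ : ∀ {m xs} ys → Contains m xs → Contains m (xs ++ ys)
  Contains-++ {m} {xs} []       c = subst (Contains m) (sym (++-identityʳ xs)) c
  Contains-++ {xs = xs} (y ∷ ys) c u v =
    ≤-trans (c u y) (≤-trans (m≤m+n _ _) (≤-reflexive (sym (walk-++ r u xs y ys v))))

  Contains⇒Rich : ∀ {ℓ t xs} → 1 ≤ ℓ → ℓ ≤ n → length xs ≤ ℓ → Unique xs → Contains t xs → Rich ℓ t E
  Contains⇒Rich {ℓ} {t} {xs} 1≤ℓ ℓ≤n xs≤ℓ u c
    with ys , u′ , len ← extend (ℓ ∸ length xs) xs u (subst (_≤ n) (sym (m+[n∸m]≡n xs≤ℓ)) ℓ≤n)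
    = close (xs ++ ys) (trans len (m+[n∸m]≡n xs≤ℓ)) u′ (Contains-++ {xs = xs} ys c)
    where
    close : ∀ L → length L ≡ ℓ → Unique L → Contains t L → Rich ℓ t E
    close []       len _  _  = contradiction (subst (1 ≤_) (sym len) 1≤ℓ) λ ()
    -- Both outer neighbours are taken to be the first vertex `x`. The loop at `x` then counts 0,
    -- and what remains is the closed walk.
    close (x ∷ zs) len uL cL = cyc (x ∷ zs) len uL
      (subst (λ b → t ≤ ind b + walk r x zs x) (irreflexive E x) (cL x x))

  -- Greedy choice: each centre in `cs` receives two neighbours off the list `Q` built so far and
  -- off the centres still reserved. This costs three vertices and gains two edges per centre, and
  -- `room` keeps the degrees large enough until the end.
  cherries : ∀ {D m} cs Q → Unique (Q ++ cs) → All (λ c → D ≤ degree c) cs →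
             length Q + 3 * length cs ≤ D → Contains m Q →
             ∃[ Q′ ] Unique Q′ × length Q′ ≡ length Q + 3 * length cs × Contains (m + 2 * length cs) Q′
  cherries {m = m} [] Q u _ _ c =
    Q , subst Unique (++-identityʳ Q) u , sym (+-identityʳ _) , subst (λ i → Contains i Q) (sym (+-identityʳ m)) c
  cherries {D} {m} (c ∷ cs) Q u (D≤c ∷ D≤cs) room long =
    let l  , cl  , l∉  = choose (r c) (Q ++ c ∷ cs) (<-trans ≤-refl enough)
        l′ , cl′ , l′∉ = choose (r c) (l ∷ Q ++ c ∷ cs) enough
        Q′ , u′ , len , long′ = cherries cs (l ∷ c ∷ l′ ∷ Q) (unique l∉ l′∉) D≤cs
                                  (subst (_≤ D) (regroup (length Q) (length cs)) room) (long″ cl cl′)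
    in Q′ , u′ , trans len (sym (regroup (length Q) (length cs))) ,
       subst (λ i → Contains i Q′) (regroup′ m (length cs)) long′
    where
    regroup : ∀ a b → a + 3 * suc b ≡ 3 + a + 3 * b
    regroup = solve-∀
    regroup′ : ∀ a b → 2 + a + 2 * b ≡ a + 2 * suc b
    regroup′ = solve-∀
    -- The additional `suc` is for the second neighbour, which must also avoid the first.
    used : suc (length (Q ++ c ∷ cs)) < length Q + 3 * length (c ∷ cs)
    used = begin
      2 + length (Q ++ c ∷ cs)            ≡⟨ cong (2 +_) (length-++ Q) ⟩
      2 + (length Q + suc (length cs))    ≡⟨ regroup″ (length Q) (length cs) ⟩
      3 + length Q + length cs            ≤⟨ +-monoʳ-≤ (3 + length Q) (m≤n*m (length cs) 3) ⟩
      3 + length Q + 3 * length cs        ≡⟨ regroup (length Q) (length cs) ⟨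
      length Q + 3 * length (c ∷ cs)      ∎
      where
      open ≤-Reasoning
      regroup″ : ∀ a b → 2 + (a + suc b) ≡ 3 + a + b
      regroup″ = solve-∀
    enough : suc (length (Q ++ c ∷ cs)) < degree c
    enough = <-≤-trans used (≤-trans room D≤c)
    unique : ∀ {l l′} → l ∉ Q ++ c ∷ cs → l′ ∉ l ∷ Q ++ c ∷ cs → Unique (l ∷ c ∷ l′ ∷ Q ++ cs)
    unique {l} {l′} l∉ l′∉ =
      ∉⇒All≢ (λ { (here e) → l∉ (there′ (here e))
                ; (there (here e)) → l′∉ (here (sym e))
                ; (there (there l∈)) → l∉ (there′ (there l∈)) }) ∷
      ∉⇒All≢ (λ { (here e) → l′∉ (there (there′ (here (sym e))))
                ; (there c∈) → Unique⇒∉ Q u c∈ }) ∷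
      ∉⇒All≢ (λ l′∈ → l′∉ (there (there′ (there l′∈)))) ∷ AllPairs.tail (Unique-↭ (shift c Q cs) u)
      where
      there′ : ∀ {x} → x ∈ c ∷ Q ++ cs → x ∈ Q ++ c ∷ cs
      there′ = ∈-resp-↭ (↭-sym (shift c Q cs))
    long″ : ∀ {l l′} → T (r c l) → T (r c l′) → Contains (2 + m) (l ∷ c ∷ l′ ∷ Q)
    long″ {l} {l′} cl cl′ x y = begin
      2 + m                                                    ≤⟨ +-monoʳ-≤ 2 (long l′ y) ⟩
      2 + walk r l′ Q y                                        ≤⟨ m≤n+m _ (ind (r x l)) ⟩
      ind (r x l) + (2 + walk r l′ Q y)
        ≡⟨ cong₂ (λ a b → ind (r x l) + (a + (b + walk r l′ Q y))) (ind-T (subst T (symmetric E c l) cl)) (ind-T cl′) ⟨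
      ind (r x l) + (ind (r l c) + (ind (r c l′) + walk r l′ Q y)) ∎
      where open ≤-Reasoning

  -- Each edge is charged to an end that lies in `C`.
  size-vertex-cover : ∀ C → (∀ u v → T (r u v) → u ∈ C ⊎ v ∈ C) → size E ≤ sumᴸ (map degree C)
  size-vertex-cover C cover = *-cancelˡ-≤ 2 (begin
    2 * size E                                     ≡⟨ handshake E ⟩
    ∑∑ (λ u v → ind (r u v))                       ≤⟨ ∑∑-mono (λ u v → bound u v _ refl) ⟩
    ∑∑ (λ u v → share u v + share v u)             ≡⟨ ∑∑-flip share ⟩
    2 * ∑∑ share                                   ≡⟨ cong (2 *_) (sum-cong-≗ λ u → *-distribˡ-sum (mult u C) (λ v → ind (r u v))) ⟨
    2 * sum (λ u → mult u C * degree u)            ≡⟨ cong (2 *_) (sum-mult degree C) ⟩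
    2 * sumᴸ (map degree C)                        ∎)
    where
    open ≤-Reasoning
    share : Fin n → Fin n → ℕ
    share u v = mult u C * ind (r u v)
    positive : ∀ {u} v → u ∈ C → T (r u v) → 1 ≤ share u v
    positive {u} v u∈ e = ≤-trans (∈⇒mult≥1 u∈) (≤-reflexive (sym (trans (cong (mult u C *_) (ind-T e)) (*-identityʳ _))))
    bound : ∀ u v b → r u v ≡ b → ind b ≤ share u v + share v u
    bound u v false _ = z≤n
    bound u v true  e with cover u v (subst T (sym e) tt)
    ... | inj₁ u∈ = ≤-trans (positive v u∈ (subst T (sym e) tt)) (m≤m+n _ _)
    ... | inj₂ v∈ = ≤-trans (positive u v∈ (subst T (sym (trans (symmetric E v u) e)) tt)) (m≤n+m _ _)

  -- Greedy choice: if no edge avoided both `H` and the matching found so far, their vertices would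
  -- form a vertex cover. Those in `H` cover at most `n` edges each and the fewer than `2 * t`
  -- others at most `D` each, contrary to the size of `E`. Matched pairs stand next to each other in
  -- `Q`.
  matching : ∀ {D t} (H : List (Fin n)) → (∀ u → u ∉ H → degree u ≤ D) → length H * n + 2 * t * D < size E →
             ∀ i → i ≤ t → ∃[ Q ] Unique Q × length Q ≡ 2 * i × All (λ u → degree u ≤ D) Q × Contains i Q
  matching H low big zero    _   = [] , [] , refl , [] , λ _ _ → z≤n
  matching {D} {t} H low big (suc i) i<t
    with Q , u , len , lowQ , long ← matching {D} {t} H low big i (<⇒≤ i<t)
    with Fin.any? (λ x → Fin.any? λ y → T? (r x y) ×-dec ¬? (x ∈? (H ++ Q)) ×-dec ¬? (y ∈? (H ++ Q)))
  ... | yes (x , y , e , x∉ , y∉) =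
        x ∷ y ∷ Q ,
        ∉⇒All≢ (λ { (here x≡y) → loop x≡y e ; (there x∈) → x∉ (∈-++⁺ʳ H x∈) }) ∷ ∉⇒All≢ (y∉ ∘ ∈-++⁺ʳ H) ∷ u ,
        trans (cong (2 +_) len) (sym (*-suc 2 i)) ,
        low x (x∉ ∘ ∈-++⁺ˡ) ∷ low y (y∉ ∘ ∈-++⁺ˡ) ∷ lowQ ,
        λ a b → ≤-trans (s≤s (long y b)) (≤-trans (≤-reflexive (cong (_+ walk r y Q b) (sym (ind-T e)))) (m≤n+m _ (ind (r a x))))
    where
    loop : x ≡ y → T (r x y) → ⊥
    loop refl e = subst T (irreflexive E x) e
  ... | no none = contradiction big (≤⇒≯ (begin
    size E                                              ≤⟨ size-vertex-cover (H ++ Q) cover ⟩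
    sumᴸ (map degree (H ++ Q))                          ≡⟨ cong sumᴸ (map-++ degree H Q) ⟩
    sumᴸ (map degree H ++ map degree Q)                 ≡⟨ sum-++ (map degree H) (map degree Q) ⟩
    sumᴸ (map degree H) + sumᴸ (map degree Q)           ≤⟨ +-mono-≤ (sumᴸ-≤ {f = degree} (All.universal degree≤n H)) (sumᴸ-≤ {f = degree} lowQ) ⟩
    length H * n + length Q * D                         ≡⟨ cong (λ m → length H * n + m * D) len ⟩
    length H * n + 2 * i * D                            ≤⟨ +-monoʳ-≤ (length H * n) (*-monoˡ-≤ D (*-monoʳ-≤ 2 (<⇒≤ i<t))) ⟩
    length H * n + 2 * t * D                            ∎))
    where
    open ≤-Reasoning
    cover : ∀ x y → T (r x y) → x ∈ H ++ Q ⊎ y ∈ H ++ Q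
    cover x y e with x ∈? (H ++ Q) | y ∈? (H ++ Q)
    ... | yes x∈ | _ = inj₁ x∈
    ... | _ | yes y∈ = inj₂ y∈
    ... | no x∉ | no y∉ = contradiction (x , y , e , x∉ , y∉) none

  size⇒Rich : ∀ q → 4 * suc q ≤ n → q * n + 2 * (2 * suc q) * (3 * suc q) < size E →
              Rich (4 * suc q) (2 * suc q) E
  size⇒Rich q 4k≤n big = split (k ≤? length high)
    where
    k = suc q
    -- The threshold is the number of vertices in `k` disjoint paths with two edges. These have
    -- `2 * k` edges, half of the cycle, as does the matching used otherwise, which fills all
    -- `4 * k` vertices.
    high = filter (λ u → 3 * k ≤? degree u) (allFin n)
    high⇒degree : All (λ u → 3 * k ≤ degree u) high
    high⇒degree = All.all-filter (λ u → 3 * k ≤? degree u) (allFin n)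
    split : Dec (k ≤ length high) → Rich (4 * k) (2 * k) E
    split (yes k≤) =
      let Q , u , len , c = cherries (take k high) [] (Unique.take⁺ k (Unique.filter⁺ _ (Unique.allFin⁺ n)))
                              (All.take⁺ k high⇒degree) (≤-reflexive (cong (3 *_) len-take)) (λ _ _ → z≤n)
      in Contains⇒Rich (s≤s z≤n) 4k≤n
           (≤-trans (≤-reflexive (trans len (cong (3 *_) len-take))) (*-monoˡ-≤ k (n≤1+n 3)))
           u (subst (λ i → Contains (2 * i) Q) len-take c)
      where
      len-take : length (take k high) ≡ k
      len-take = trans (length-take k high) (m≤n⇒m⊓n≡m k≤)
    split (no k≰) =
      let Q , u , len , _ , c = matching high low (≤-<-trans (+-monoˡ-≤ _ (*-monoˡ-≤ n (s≤s⁻¹ (≰⇒> k≰)))) big) (2 * k) ≤-refl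
      in Contains⇒Rich (s≤s z≤n) 4k≤n
           (≤-reflexive (trans len (sym (*-assoc 2 2 k)))) u c
      where
      low : ∀ u → u ∉ high → degree u ≤ 3 * k
      low u u∉ = <⇒≤ (≰⇒> λ 3k≤ → u∉ (∈-filter⁺ (λ u → 3 * k ≤? degree u) (∈-allFin u) 3k≤))

-- The extremal number and its lower bound

module _ {n : ℕ} where
  open import Data.List.Relation.Unary.Unique.DecPropositional (_≟_ {n}) public using (unique?)

Searchable : Set → Set₁
Searchable A = ∀ {P : A → Set} → Decidable P → Dec (∃ P)

search-Bool : Searchable Bool
search-Bool P? = map′ (λ { (inj₁ p) → true , p ; (inj₂ p) → false , p })
                      (λ { (true , p) → inj₁ p ; (false , p) → inj₂ p }) (P? true ⊎-dec P? false)

search-Vec : ∀ {A} → Searchable A → ∀ n → Searchable (Vec A n)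
search-Vec s zero    P? = map′ ([] ,_) (λ { ([] , p) → p }) (P? [])
search-Vec s (suc n) P? = map′ (λ (x , xs , p) → (x ∷ xs) , p) (λ { (x ∷ xs , p) → x , xs , p })
                               (s λ x → search-Vec s n λ xs → P? (x ∷ xs))

Rich-cong : ∀ {n} (E F : EdgeSet n) → (∀ u v → adj E u v ≡ adj F u v) → ∀ {ℓ t} → Rich ℓ t E → Rich ℓ t F
Rich-cong E F E≡F (cyc vs len u p) = cyc vs len u (subst (_ ≤_) (closed-cong E≡F vs) p)

Rich? : ∀ {n} ℓ t (E : EdgeSet n) → Dec (Rich ℓ t E)
Rich? {n} ℓ t E = map′
  (λ (vs , u , p) → cyc (Vec.toList vs) (length-toList vs) u p)
  (λ { (cyc vs refl u p) → Vec.fromList vs , subst (λ L → Unique L × t ≤ closed (adj E) L) (sym (toList∘fromList vs)) (u , p) })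
  (search-Vec Fin.any? ℓ λ vs → unique? (Vec.toList vs) ×-dec t ≤? closed (adj E) (Vec.toList vs))

-- Edge sets are functions, so an exhaustive search has to go through their adjacency tables.
fromTable : ∀ {n} → Vec (Vec Bool n) n → EdgeSet n
fromTable M = offDiagonal (λ u v → entry u v ∨ entry v u) (λ u v → ∨-comm (entry u v) (entry v u))
  where entry = λ u v → Vec.lookup (Vec.lookup M u) v

toTable : ∀ {n} → EdgeSet n → Vec (Vec Bool n) n
toTable E = Vec.tabulate λ u → Vec.tabulate (adj E u)

adj-fromTable : ∀ {n} (E : EdgeSet n) u v → adj (fromTable (toTable E)) u v ≡ adj E u v
adj-fromTable E u v = trans (cong₂ (λ a b → distinct u v ∧ (a ∨ b)) (entry u v) (trans (entry v u) (symmetric E v u)))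
                            (trans (cong (distinct u v ∧_) (∨-idem (adj E u v))) offDiag)
  where
  entry : ∀ u v → Vec.lookup (Vec.lookup (toTable E) u) v ≡ adj E u v
  entry u v = trans (cong (λ row → Vec.lookup row v) (lookup∘tabulate (λ u → Vec.tabulate (adj E u)) u))
                    (lookup∘tabulate (adj E u) v)
  offDiag : distinct u v ∧ adj E u v ≡ adj E u v
  offDiag with u ≟ v
  ... | yes refl = sym (irreflexive E u)
  ... | no _     = refl

Poor : ∀ {n} → ℕ → ℕ → ℕ → Set
Poor {n} ℓ t j = Σ (EdgeSet n) λ E → j ≤ size E × ¬ Rich ℓ t E

-- A constructive case distinction: there are finitely many adjacency tables and richness is
-- decidable, so failure to find a poor graph proves that all graphs of this size are rich.
rich-or-poor : ∀ {n} ℓ t j → (∀ (E : EdgeSet n) → j ≤ size E → Rich ℓ t E) ⊎ Poor {n} ℓ t j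
rich-or-poor {n} ℓ t j
  with search-Vec (search-Vec search-Bool n) n
         (λ M → j ≤? size (fromTable M) ×-dec ¬? (Rich? ℓ t (fromTable M)))
... | yes (M , p) = inj₂ (fromTable M , p)
... | no none = inj₁ λ E j≤ → Rich-cong (fromTable (toTable E)) E (adj-fromTable E)
      (decidable-stable (Rich? ℓ t (fromTable (toTable E))) λ poor →
        none (toTable E , ≤-trans j≤ (≤-reflexive (size-cong E (fromTable (toTable E)) λ u v → sym (adj-fromTable E u v))) , poor))

-- Searches upwards from `lo`, by induction on the gap `d`, and stops as soon as all larger graphs
-- are rich. The resulting `m` is the largest size of a poor graph.
extremal-size : ∀ {n ℓ t} d lo → Poor {n} ℓ t lo → (∀ (E : EdgeSet n) → lo + d ≤ size E → Rich ℓ t E) →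
  ∃[ m ] lo ≤ m × m < lo + d × Poor {n} ℓ t m × (∀ (E : EdgeSet n) → m < size E → Rich ℓ t E)
extremal-size zero lo (E , lo≤ , poor) hi = contradiction (hi E (≤-trans (≤-reflexive (+-identityʳ lo)) lo≤)) poor
extremal-size {n} {ℓ} {t} (suc d) lo poor hi with rich-or-poor {n} ℓ t (suc lo)
... | inj₁ rich = lo , ≤-refl , m<m+n lo (s≤s z≤n) , poor , rich
... | inj₂ poor′ with extremal-size d (suc lo) poor′ (λ E → hi E ∘ ≤-trans (≤-reflexive (+-suc lo d)))
...   | m , lo<m , m<hi , rest = m , <⇒≤ lo<m , <-≤-trans m<hi (≤-reflexive (sym (+-suc lo d))) , rest

extremal-between : ∀ {n ℓ t lo hi} → lo ≤ hi → Poor {n} ℓ t lo → (∀ (E : EdgeSet n) → hi ≤ size E → Rich ℓ t E) →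
  ∃[ m ] lo ≤ m × m < hi × Poor {n} ℓ t m × (∀ (E : EdgeSet n) → m < size E → Rich ℓ t E)
extremal-between {n} {ℓ} {t} {lo} lo≤hi poor rich =
  subst (λ h → ∃[ m ] lo ≤ m × m < h × Poor {n} ℓ t m × (∀ (E : EdgeSet n) → m < size E → Rich ℓ t E))
        (m+[n∸m]≡n lo≤hi)
        (extremal-size _ lo poor λ E → rich E ∘ subst (_≤ size E) (m+[n∸m]≡n lo≤hi))

-- Complete bipartite graphs without rich cycles

-- The weights `f` cover every edge by its two ends. An inner vertex of the walk pays for two edges,
-- an end for one.
walk-≤ : ∀ {V : Set} {r : V → V → Bool} (f : V → ℕ) → (∀ u v → ind (r u v) ≤ f u + f v) →
         ∀ u xs v → walk r u xs v ≤ f u + 2 * sumᴸ (map f xs) + f v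
walk-≤ f r≤f u [] v = ≤-trans (r≤f u v) (≤-reflexive (cong (_+ f v) (sym (+-identityʳ (f u)))))
walk-≤ f r≤f u (x ∷ xs) v = ≤-trans (+-mono-≤ (r≤f u x) (walk-≤ f r≤f x xs v))
                                    (≤-reflexive (regroup (f u) (f x) (sumᴸ (map f xs)) (f v)))
  where
  regroup : ∀ a b s c → a + b + (b + 2 * s + c) ≡ a + 2 * (b + s) + c
  regroup = solve-∀

closed-≤ : ∀ {V : Set} {r : V → V → Bool} (f : V → ℕ) → (∀ u v → ind (r u v) ≤ f u + f v) →
           ∀ xs → closed r xs ≤ 2 * sumᴸ (map f xs)
closed-≤ f r≤f []       = z≤n
closed-≤ f r≤f (x ∷ xs) = ≤-trans (walk-≤ f r≤f x xs x) (≤-reflexive (regroup (f x) (sumᴸ (map f xs))))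
  where
  regroup : ∀ a s → a + 2 * s + a ≡ 2 * (a + s)
  regroup = solve-∀

sumᴸ-Unique : ∀ {n} (f : Fin n → ℕ) {xs} → Unique xs → sumᴸ (map f xs) ≤ sum f
sumᴸ-Unique f {xs} u = ≤-trans (≤-reflexive (sym (sum-mult f xs)))
  (sum-mono λ z → ≤-trans (*-monoˡ-≤ (f z) (Unique⇒mult≤1 u)) (≤-reflexive (*-identityˡ (f z))))

sum-below : ∀ {n q} → q ≤ n → sum {n} (λ i → ind (toℕ i <ᵇ q)) ≡ q
sum-below {n}     {zero}  _         = sum-zero {n} λ _ → refl
sum-below {suc n} {suc q} (s≤s q≤n) = cong suc (sum-below q≤n)

module _ (n q : ℕ) where

  private
    core : Fin n → Bool
    core u = toℕ u <ᵇ q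

  bipartite : EdgeSet n
  bipartite = offDiagonal (λ u v → core u xor core v) (λ u v → xor-comm (core u) (core v))

  size-bipartite : q ≤ n → size bipartite ≡ q * (n ∸ q)
  size-bipartite q≤n = *-cancelˡ-≡ _ _ 2 (begin
    2 * size bipartite                             ≡⟨ handshake bipartite ⟩
    ∑∑ (λ u v → ind (adj bipartite u v))           ≡⟨ ∑∑-cong split ⟩
    ∑∑ (λ u v → arc u v + arc v u)                 ≡⟨ ∑∑-flip arc ⟩
    2 * ∑∑ arc                                     ≡⟨ cong (2 *_) (∑∑-* (ind ∘ core) (ind ∘ not ∘ core)) ⟩
    2 * (sum (ind ∘ core) * sum (ind ∘ not ∘ core)) ≡⟨ cong₂ (λ a b → 2 * (a * b)) (sum-below q≤n) outside ⟩
    2 * (q * (n ∸ q))                              ∎)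
    where
    open ≡-Reasoning
    arc : Fin n → Fin n → ℕ
    arc u v = ind (core u) * ind (not (core v))
    xor-split : ∀ a b → ind (a xor b) ≡ ind a * ind (not b) + ind b * ind (not a)
    xor-split true  true  = refl
    xor-split true  false = refl
    xor-split false true  = refl
    xor-split false false = refl
    split : ∀ u v → ind (adj bipartite u v) ≡ arc u v + arc v u
    split u v with u ≟ v
    ... | no _ = xor-split (core u) (core v)
    ... | yes refl with core u
    ...   | true  = refl
    ...   | false = refl
    outside : sum (ind ∘ not ∘ core) ≡ n ∸ q
    outside = +-cancelˡ-≡ q _ _ (begin
      q + sum (ind ∘ not ∘ core)                     ≡⟨ cong (_+ sum (ind ∘ not ∘ core)) (sum-below q≤n) ⟨
      sum (ind ∘ core) + sum (ind ∘ not ∘ core)      ≡⟨ ∑-distrib-+ (ind ∘ core) (ind ∘ not ∘ core) ⟨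
      sum (λ u → ind (core u) + ind (not (core u)))  ≡⟨ sum-cong-≗ (ind-not ∘ core) ⟩
      sum {n} (λ _ → 1)                              ≡⟨ trans (sum-const n 1) (*-identityʳ n) ⟩
      n                                              ≡⟨ m+[n∸m]≡n q≤n ⟨
      q + (n ∸ q)                                    ∎)

  -- Every edge meets one of the `q` core vertices, and each of these lies on at most two edges of a
  -- cycle.
  bipartite-poor : q ≤ n → ∀ {ℓ} → ¬ Rich ℓ (2 * suc q) bipartite
  bipartite-poor q≤n (cyc vs _ u p) = <-irrefl refl (begin-strict
    2 * q                                   <⟨ *-monoʳ-< 2 (n<1+n q) ⟩
    2 * suc q                               ≤⟨ p ⟩
    closed (adj bipartite) vs               ≤⟨ closed-≤ (ind ∘ core) touches vs ⟩
    2 * sumᴸ (map (ind ∘ core) vs)          ≤⟨ *-monoʳ-≤ 2 (sumᴸ-Unique (ind ∘ core) u) ⟩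
    2 * sum (ind ∘ core)                    ≡⟨ cong (2 *_) (sum-below q≤n) ⟩
    2 * q                                   ∎)
    where
    open ≤-Reasoning
    touches : ∀ u v → ind (adj bipartite u v) ≤ ind (core u) + ind (core v)
    touches u v with distinct u v | core u | core v
    ... | false | _     | _     = z≤n
    ... | true  | true  | true  = z≤n
    ... | true  | true  | false = ≤-refl
    ... | true  | false | true  = ≤-refl
    ... | true  | false | false = ≤-refl

-- The two balancing numbers

open import Data.Integer using (+_)

module _ {V : Set} {r b : V → V → Bool} (covered : ∀ {u v} → u ≢ v → T (r u v ∨ b u v)) where

  private
    one : ∀ {u v} → u ≢ v → 1 ≤ ind (r u v) + ind (b u v)
    one {u} {v} u≢v with r u v | b u v | covered u≢v
    ... | true  | _    | _ = s≤s z≤n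
    ... | false | true | _ = s≤s z≤n

    shuffle : ∀ a b c d → a + b + (c + d) ≡ a + c + (b + d)
    shuffle = solve-∀

  walk-covered : ∀ u x xs v → Unique (u ∷ x ∷ xs) → All (v ≢_) (x ∷ xs) →
                 2 + length xs ≤ walk r u (x ∷ xs) v + walk b u (x ∷ xs) v
  walk-covered u x [] v ((u≢x ∷ _) ∷ _) (v≢x ∷ _) =
    ≤-trans (+-mono-≤ (one u≢x) (one (v≢x ∘ sym)))
            (≤-reflexive (shuffle (ind (r u x)) (ind (b u x)) (ind (r x v)) (ind (b x v))))
  walk-covered u x (y ∷ xs) v ((u≢x ∷ _) ∷ uq) (_ ∷ v≢) =
    ≤-trans (+-mono-≤ (one u≢x) (walk-covered x y xs v uq v≢))
            (≤-reflexive (shuffle (ind (r u x)) (ind (b u x)) _ _))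

  -- Consecutive vertices are distinct, so every edge of the cycle has a colour. Hence a cycle with
  -- exactly half of its edges red has at least half of them blue, even if the colours overlap.
  closed-covered : ∀ xs → 2 ≤ length xs → Unique xs → length xs ≤ closed r xs + closed b xs
  closed-covered (x ∷ [])     (s≤s ()) _
  closed-covered (x ∷ y ∷ xs) _ u@(x≢ ∷ _) = walk-covered x y xs x u x≢

balanced-if-rich : ∀ {n} (R B : EdgeSet n) → (∀ {u v} → u ≢ v → T (adj R u v ∨ adj B u v)) →
  ∀ {ℓ t} → suc ℓ < n → 3 ≤ ℓ → ℓ ≡ t + t → odd t ≡ false →
  Rich ℓ t R → Rich ℓ t B → BalancedCopy R B (cycle ℓ)
balanced-if-rich R B covered {ℓ} {t} room 3≤ℓ ℓ≡t+t odd-t (cyc us lenU uU t≤r) (cyc ws lenW uW t≤b) =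
  cycle⇒balanced R B covered 3≤ℓ ℓ≡t+t (find (m≤n⇒m<n∨m≡n t≤r))
  where
  open Switching (adj R) (symmetric R) {ℓ} {t} room 3≤ℓ (trans (cong odd ℓ≡t+t) (odd-double t)) odd-t
  Both = CycleWith ℓ λ vs → t ≤ closed (adj R) vs × t ≤ closed (adj B) vs
  exact : Balanced → Both
  exact (cyc vs len u r≡t) = cyc vs len u (≤-reflexive (sym r≡t) , +-cancelˡ-≤ t _ _ (begin
    t + t                                      ≡⟨ ℓ≡t+t ⟨
    ℓ                                          ≡⟨ len ⟨
    length vs                                  ≤⟨ closed-covered covered vs (≤-trans (n≤1+n 2) (subst (3 ≤_) (sym len) 3≤ℓ)) u ⟩
    closed (adj R) vs + closed (adj B) vs      ≡⟨ cong (_+ closed (adj B) vs) r≡t ⟩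
    t + closed (adj B) vs                      ∎))
    where open ≤-Reasoning
  find : t < closed (adj R) us ⊎ t ≡ closed (adj R) us → Both
  find (inj₂ t≡r) = exact (cyc us lenU uU (sym t≡r))
  find (inj₁ t<r) with connect (lenU , uU , t<r) lenW uW
  ... | inj₁ bal = exact bal
  -- All replacements stayed above `t`, so the blue-rich target is rich in red too.
  ... | inj₂ (_ , _ , t<r′) = cyc ws lenW uW (<⇒≤ t<r′ , t≤b)

list-covered : ∀ {n} (L : ListColouring n) {u v} → u ≢ v → T (adj (red L) u v ∨ adj (blue L) u v)
list-covered L {u} {v} u≢v rewrite distinct-≢ u≢v with list L u v
... | ⟨r⟩  = tt
... | ⟨b⟩  = tt
... | ⟨rb⟩ = tt

partition-covered : ∀ {n} {R B : EdgeSet n} → complete n ≐ R ⊔ B →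
                    ∀ {u v} → u ≢ v → T (adj R u v ∨ adj B u v)
partition-covered partition {u} {v} u≢v =
  subst T (trans (cong (_∧ true) (sym (distinct-≢ u≢v))) (_≐_⊔_.cover partition u v)) tt

complement-partition : ∀ {n} (E : EdgeSet n) → complete n ≐ E ⊔ complement E
complement-partition E = record { cover = cover ; disjoint = disjoint }
  where
  cover : ∀ u v → distinct u v ∧ true ≡ adj E u v ∨ (distinct u v ∧ not (adj E u v))
  cover u v with u ≟ v
  ... | yes refl = sym (trans (∨-identityʳ _) (irreflexive E u))
  ... | no _ with adj E u v
  ...   | true  = refl
  ...   | false = refl
  disjoint : ∀ u v → adj E u v ∧ (distinct u v ∧ not (adj E u v)) ≡ false
  disjoint u v with adj E u v
  ... | true  = ∧-zeroʳ (distinct u v)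
  ... | false = refl

-- A 2-coloring viewed as a list coloring with singleton lists, through which a poor graph bounds
-- the list balancing number as well.
colouring : ∀ {n} → EdgeSet n → ListColouring n
colouring E = record
  { list     = λ u v → colour (adj E u v)
  ; list-sym = λ u v → cong colour (symmetric E u v)
  }
  where
  colour : Bool → Palette
  colour true  = ⟨r⟩
  colour false = ⟨b⟩

red-colouring : ∀ {n} (E : EdgeSet n) u v → adj (red (colouring E)) u v ≡ adj E u v
red-colouring E u v with u ≟ v
... | yes refl = sym (irreflexive E u)
... | no _ with adj E u v
...   | true  = refl
...   | false = refl

blue-colouring : ∀ {n} (E : EdgeSet n) u v → adj (blue (colouring E)) u v ≡ adj (complement E) u v
blue-colouring E u v with adj E u v
... | true  = refl
... | false = refl

-- Numerical estimates

pos-^2 : ∀ k → (+ k) ℤ.^ 2 ≡ + (k ^ 2)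
pos-^2 k = trans (cong (+ k ℤ.*_) (sym (ℤ.pos-* k 1))) (sym (ℤ.pos-* k (k * 1)))

module Arithmetic (q n : ℕ) (hyp : 144 * suc q ^ 2 + 104 * suc q + 49 ≤ 32 * n) where

  private
    k = suc q

  open ≤-Reasoning

  upper : ℕ
  upper = q * n + 12 * k ^ 2 + 3 * k

  -- The linear form in which the quadratic hypothesis enters the inequalities below;
  -- `9 + (144 * (q * q) + 40 * q)` is the slack.
  11q+10≤n : 11 * q + 10 ≤ n
  11q+10≤n = subst (_≤ n) (sym (+-suc (11 * q) 9)) (*-cancelˡ-< 32 _ _ (begin-strict
    32 * (11 * q + 9)                                  <⟨ m<m+n _ (s≤s z≤n) ⟩
    32 * (11 * q + 9) + (9 + (144 * (q * q) + 40 * q)) ≡⟨ regroup q ⟩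
    144 * k ^ 2 + 104 * k + 49                         ≤⟨ hyp ⟩
    32 * n                                             ∎))
    where
    regroup : ∀ q → 32 * (11 * q + 9) + (9 + (144 * (q * q) + 40 * q)) ≡ 144 * (suc q * (suc q * 1)) + 104 * suc q + 49
    regroup = solve-∀

  q≤n : q ≤ n
  q≤n = ≤-trans (m≤n*m q 11) (≤-trans (m≤m+n _ 10) 11q+10≤n)

  room : suc (4 * k) < n
  room = begin
    2 + 4 * suc q                      ≤⟨ m≤m+n _ (7 * q + 4) ⟩
    2 + 4 * suc q + (7 * q + 4)        ≡⟨ regroup q ⟩
    11 * q + 10                        ≤⟨ 11q+10≤n ⟩
    n                                  ∎
    where
    regroup : ∀ q → 2 + 4 * suc q + (7 * q + 4) ≡ 11 * q + 10
    regroup = solve-∀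

  -- Makes the condition on the color classes satisfiable and the complement of a poor graph large.
  -- After doubling, the terms free of `n` are enlarged to `(7 * q + 9) * (11 * q + 10)`, at most
  -- `(7 * q + 9) * n`; the coefficients of `n` then add up to `11 * q + 10`, again at most `n`.
  2*upper≤nC2 : 2 * upper ≤ n C 2
  2*upper≤nC2 = *-cancelˡ-≤ 2 (+-cancelʳ-≤ n _ _ (begin
    2 * (2 * upper) + n                                                    ≡⟨ expand q n ⟩
    (4 * q + 1) * n + (48 * (q * q) + 108 * q + 60)                        ≤⟨ +-monoʳ-≤ ((4 * q + 1) * n) (m≤m+n _ (29 * (q * q) + 61 * q + 30)) ⟩
    (4 * q + 1) * n + (48 * (q * q) + 108 * q + 60 + (29 * (q * q) + 61 * q + 30)) ≡⟨ cong (λ c → (4 * q + 1) * n + c) (factor q) ⟩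
    (4 * q + 1) * n + (7 * q + 9) * (11 * q + 10)                          ≤⟨ +-monoʳ-≤ ((4 * q + 1) * n) (*-monoʳ-≤ (7 * q + 9) 11q+10≤n) ⟩
    (4 * q + 1) * n + (7 * q + 9) * n                                      ≡⟨ collect q n ⟩
    (11 * q + 10) * n                                                      ≤⟨ *-monoˡ-≤ n 11q+10≤n ⟩
    n * n                                                                  ≡⟨ 2*nC2 n ⟨
    2 * (n C 2) + n                                                        ∎))
    where
    expand : ∀ q n → 2 * (2 * (q * n + 12 * (suc q * (suc q * 1)) + 3 * suc q)) + n
                     ≡ (4 * q + 1) * n + (48 * (q * q) + 108 * q + 60)
    expand = solve-∀
    factor : ∀ q → 48 * (q * q) + 108 * q + 60 + (29 * (q * q) + 61 * q + 30) ≡ (7 * q + 9) * (11 * q + 10)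
    factor = solve-∀
    collect : ∀ q n → (4 * q + 1) * n + (7 * q + 9) * n ≡ (11 * q + 10) * n
    collect = solve-∀

  rich-threshold : q * n + 2 * (2 * k) * (3 * k) < upper
  rich-threshold = begin-strict
    q * n + 2 * (2 * k) * (3 * k)              <⟨ m<m+n _ {3 * k} (s≤s z≤n) ⟩
    q * n + 2 * (2 * k) * (3 * k) + 3 * k      ≡⟨ regroup q (q * n) ⟩
    upper                                      ∎
    where
    regroup : ∀ q m → m + 2 * (2 * suc q) * (3 * suc q) + 3 * suc q ≡ m + 12 * (suc q * (suc q * 1)) + 3 * suc q
    regroup = solve-∀

  lower≤upper : q * (n ∸ q) ≤ upper
  lower≤upper = ≤-trans (*-monoʳ-≤ q (m∸n≤m n q)) (≤-trans (m≤m+n _ _) (m≤m+n _ (3 * k)))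

-- The common value of both balancing numbers

module _ (q n : ℕ) (hyp : 144 * suc q ^ 2 + 104 * suc q + 49 ≤ 32 * n) where

  open Arithmetic q n hyp

  private
    k = suc q
    ℓ = 4 * k
    t = 2 * k

    3≤ℓ : 3 ≤ ℓ
    3≤ℓ = ≤-trans (n≤1+n 3) (*-monoʳ-≤ 4 (s≤s z≤n))

    ℓ≡t+t : ℓ ≡ t + t
    ℓ≡t+t = double k
      where
      double : ∀ k → 4 * k ≡ 2 * k + 2 * k
      double = solve-∀

    odd-t : odd t ≡ false
    odd-t = trans (cong odd (cong (λ m → k + m) (+-identityʳ k))) (odd-double k)

    upper-rich : ∀ (E : EdgeSet n) → upper ≤ size E → Rich ℓ t E
    upper-rich E big = size⇒Rich E q (≤-trans (n≤1+n _) (<⇒≤ room)) (<-≤-trans rich-threshold big)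

  private
    poor-lower : Poor {n} ℓ t (q * (n ∸ q))
    poor-lower = bipartite n q , ≤-reflexive (sym (size-bipartite n q q≤n)) , bipartite-poor n q q≤n

  extremal : ∃[ m ] q * (n ∸ q) ≤ m × m < upper × Poor {n} ℓ t m × (∀ (E : EdgeSet n) → m < size E → Rich ℓ t E)
  extremal = extremal-between {n} {ℓ} {t} {q * (n ∸ q)} {upper} lower≤upper poor-lower upper-rich

  balanced-above : ∀ {m} → (∀ (E : EdgeSet n) → m < size E → Rich ℓ t E) →
                   (R B : EdgeSet n) → (∀ {u v} → u ≢ v → T (adj R u v ∨ adj B u v)) →
                   + m ℤ.< + size R → + m ℤ.< + size B → BalancedCopy R B (cycle ℓ)
  balanced-above rich R B covered m<R m<B =
    balanced-if-rich R B covered room 3≤ℓ ℓ≡t+t odd-t (rich R (ℤ.drop‿+<+ m<R)) (rich B (ℤ.drop‿+<+ m<B))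

  -- For `j` below `m`, a poor graph and its complement both have more than `j` edges: the graph has
  -- fewer than `upper` edges, hence the complement at least `upper`. A balanced copy would yield a
  -- rich cycle in the poor graph.
  poor-minimal : ∀ {m} → m < upper → (poor : Poor {n} ℓ t m) → let E = proj₁ poor in ∀ j →
                 (j ℤ.< + size E → j ℤ.< + size (complement E) → Rich ℓ t E) → + m ℤ.≤ j
  poor-minimal {m} m<upper (E , m≤E , poor) j balances = ℤ.≮⇒≥ λ j<m →
    poor (balances (ℤ.<-≤-trans j<m (ℤ.+≤+ m≤E)) (ℤ.<-≤-trans j<m (ℤ.+≤+ (<⇒≤ (<-≤-trans m<upper upper≤Ē)))))
    where
    open ≤-Reasoning
    upper≤Ē : upper ≤ size (complement E)
    upper≤Ē = +-cancelˡ-≤ upper _ _ (begin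
      upper + upper                      ≡⟨ cong (λ s → upper + s) (+-identityʳ upper) ⟨
      2 * upper                          ≤⟨ 2*upper≤nC2 ⟩
      n C 2                              ≡⟨ size-complement E ⟨
      size E + size (complement E)       ≤⟨ +-monoˡ-≤ _ (<⇒≤ (≰⇒> (poor ∘ upper-rich E))) ⟩
      upper + size (complement E)        ∎)

  lower-bound : ∀ {m} → q * (n ∸ q) ≤ m → + q ℤ.* + n ℤ.- (+ q) ℤ.^ 2 ℤ.≤ + m
  lower-bound {m} lo≤m = subst (ℤ._≤ + m) (sym (begin
    + q ℤ.* + n ℤ.- (+ q) ℤ.^ 2        ≡⟨ cong₂ ℤ._-_ (sym (ℤ.pos-* q n)) (pos-^2 q) ⟩
    + (q * n) ℤ.- + (q ^ 2)            ≡⟨ ℤ.m-n≡m⊖n (q * n) (q ^ 2) ⟩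
    (q * n) ℤ.⊖ (q ^ 2)                ≡⟨ ℤ.⊖-≥ (*-monoʳ-≤ q (≤-trans (≤-reflexive (*-identityʳ q)) q≤n)) ⟩
    + (q * n ∸ q * (q * 1))            ≡⟨ cong +_ (*-distribˡ-∸ q n (q * 1)) ⟨
    + (q * (n ∸ q * 1))                ≡⟨ cong (λ p → + (q * (n ∸ p))) (*-identityʳ q) ⟩
    + (q * (n ∸ q))                    ∎)) (ℤ.+≤+ lo≤m)
    where open ≡-Reasoning

  upper-bound : ∀ {m} → m < upper → + m ℤ.< + q ℤ.* + n ℤ.+ + 12 ℤ.* (+ k) ℤ.^ 2 ℤ.+ + 3 ℤ.* + k
  upper-bound {m} m<upper = subst (+ m ℤ.<_) (sym
    (cong₂ ℤ._+_ (cong₂ ℤ._+_ (sym (ℤ.pos-* q n)) (trans (cong (+ 12 ℤ.*_) (pos-^2 k)) (sym (ℤ.pos-* 12 (k ^ 2)))))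
                 (sym (ℤ.pos-* 3 k))))
    (ℤ.+<+ m<upper)

  twice : ∀ {m} → m < upper → + 2 ℤ.* (+ m ℤ.+ 1ℤ) ℤ.≤ + (n C 2)
  twice {m} m<upper = subst (ℤ._≤ + (n C 2)) (ℤ.pos-* 2 (m + 1))
    (ℤ.+≤+ (≤-trans (*-monoʳ-≤ 2 (≤-trans (≤-reflexive (+-comm m 1)) m<upper)) 2*upper≤nC2))

  lbal≡bal : ∃[ m ] IsLbal n (cycle ℓ) m × IsBal n (cycle ℓ) m
           × + q ℤ.* + n ℤ.- (+ q) ℤ.^ 2 ℤ.≤ m
           × m ℤ.< + q ℤ.* + n ℤ.+ + 12 ℤ.* (+ k) ℤ.^ 2 ℤ.+ + 3 ℤ.* + k
  lbal≡bal =
    let m , lo≤m , m<upper , poor , rich = extremal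
        E = proj₁ poor
    in
    + m
    , (<⇒≤ (<-trans (n<1+n ℓ) room)
      , (λ L → balanced-above rich (red L) (blue L) (list-covered L))
      , λ j balances → poor-minimal m<upper poor j λ j<E j<Ē →
          Rich-cong (red (colouring E)) E (red-colouring E) (balanced⇒rich _ (blue (colouring E)) 3≤ℓ ℓ≡t+t
            (balances (colouring E)
              (subst (λ s → j ℤ.< + s) (sym (size-cong (red (colouring E)) E (red-colouring E))) j<E)
              (subst (λ s → j ℤ.< + s) (sym (size-cong (blue (colouring E)) (complement E) (blue-colouring E))) j<Ē))))
    , (((λ R B partition → balanced-above rich R B (partition-covered partition)) , twice m<upper)
      , λ j (balances , _) → poor-minimal m<upper poor j λ j<E j<Ē →
          balanced⇒rich E (complement E) 3≤ℓ ℓ≡t+t (balances E (complement E) (complement-partition E) j<E j<Ē))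
    , lower-bound lo≤m
    , upper-bound m<upper

theorem9 : (k n : ℕ) → 1 ℕ.≤ k →
    -- n ≥ (9/2) k² + (13/4) k + 49/32, multiplied by 32
    144 ℕ.* k ℕ.^ 2 ℕ.+ 104 ℕ.* k ℕ.+ 49 ℕ.≤ 32 ℕ.* n →
    ∃[ m ] IsLbal n (cycle (4 ℕ.* k)) m
         × IsBal n (cycle (4 ℕ.* k)) m
         × (+ k ℤ.- 1ℤ) ℤ.* + n ℤ.- (+ k ℤ.- 1ℤ) ℤ.^ 2 ℤ.≤ m
         × m ℤ.< (+ k ℤ.- 1ℤ) ℤ.* + n ℤ.+ + 12 ℤ.* (+ k) ℤ.^ 2 ℤ.+ + 3 ℤ.* + k
-- With `k` in the form `suc q`, the integer `+ k ℤ.- 1ℤ` computes to `+ q`.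
theorem9 (suc q) n _ hyp = lbal≡bal q n hyp
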